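{- For all positive integers $n$, there exists a directed acyclic graph $G^*=(V,E)$ with edge weights of the form $$a_{e,1}\lambda_1+a_{e,2}\lambda_2+\cdots+a_{e,d}\lambda_d+a_{e,d+1}$$ such that $$|\mathrm{MSPC}(G^*)|\in n^{\Omega(d\log n)}.$$
   Context: Here $d$ is a positive integer, the number of real parameters. Standing convention: unless otherwise explicitly stated, all graphs are simple (no multi-edges or self-loops), directed, and connected, with vertex set $V$ where $|V|=n$. Logarithms are to base 2. A graph $G$ has two special vertices, a source $s$ and a sink $t$. The parameters $\overline{\lambda}=(\lambda_1,\dots,\lambda_d)\in\mathbb{R}^d$ are common to the entire graph, while the coefficients $a_{e,i}\in\mathbb{R}$, for $i\in\{1,\dots,d+1\}$, are fixed constants for each edge $e$; the weight of edge $e$ is $\mathsf{wt}(e)=a_{e,1}\lambda_1+\cdots+a_{e,d}\lambda_d+a_{e,d+1}$. The weight of a path $P$ from $s$ to $t$ is $\mathsf{wt}(P)=\sum_{e\in P}\mathsf{wt}(e)$. Let $\mathcal{P}_{s,t}$ be the set of paths from $s$ to $t$ in $G$. A path is a shortest path in $G$ at $\overline{\lambda}=\overline{x}$ if it is a shortest path from $s$ to $t$ in the fixed-edge-weight graph obtained by setting $\overline{\lambda}=\overline{x}$ in all edge weights of $G$. A Minimum Shortest Path Cover $\mathrm{MSPC}(G)$ is a minimum-sized subset $\mathcal{S}\subseteq\mathcal{P}_{s,t}$ such that for every $\overline{x}\in\mathbb{R}^d$ there is a path $P\in\mathcal{S}$ which is a shortest path in $G$ at $\overline{\lambda}=\overline{x}$;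 $|\mathrm{MSPC}(G)|$ denotes its size. -}

module Defs where

open import Data.Bool.Base using (Bool; T)
open import Data.Fin.Base using (Fin; inject₁; fromℕ)
open import Data.List.Base using (List; []; _∷_; length)
open import Data.List.Membership.Propositional using (_∈_)
open import Data.List.Relation.Unary.All using (All)
open import Data.List.Relation.Unary.Unique.Propositional using (Unique)
open import Data.Nat.Base as ℕ using (ℕ; suc; _⊔_)
import Data.Nat.Properties as ℕ
open import Data.Product.Base using (Σ-syntax; ∃-syntax; _×_; _,_)
open import Data.Rational.Base as ℚ
  using (ℚ; 0ℚ; 1ℚ; ½; ∣_∣; _+_; _*_; _-_; -_; _≤_; _<_; 1/_; Positive; positive)
open import Data.Rational.Properties
open import Data.Rational.Solver using (module +-*-Solver)
open import Data.Vec.Functional using (Vector; foldr)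
open import Relation.Binary.Construct.Closure.Equivalence using (EqClosure)
open import Relation.Binary.Construct.Closure.ReflexiveTransitive using (Star; ε; _◅_)
open import Relation.Binary.Construct.Closure.Transitive using (TransClosure)
open import Relation.Binary.PropositionalEquality
  using (_≡_; refl; sym; trans; cong; cong₂; subst)
open import Relation.Nullary using (¬_)

------------------------------------------------------------------------
-- Real numbers, as Cauchy sequences of rationals with a modulus of
-- convergence.  Equality of reals is mutual _≤ᴿ_; it is not needed below.

IsCauchy : (ℕ → ℚ) → Set
IsCauchy x = ∀ δ → 0ℚ < δ →
  Σ[ N ∈ ℕ ] (∀ m n → N ℕ.≤ m → N ℕ.≤ n → ∣ x m - x n ∣ < δ)

record ℝ : Set where
  constructor mkℝ
  field
    seq    : ℕ → ℚ
    cauchy : IsCauchy seq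

open ℝ public

infix  4 _≤ᴿ_
infixl 6 _+ᴿ_
infixl 7 _*ᴿ_

_≤ᴿ_ : ℝ → ℝ → Set
x ≤ᴿ y = ∀ δ → 0ℚ < δ →
  Σ[ N ∈ ℕ ] (∀ n → N ℕ.≤ n → seq x n ≤ seq y n + δ)

fromℚ : ℚ → ℝ
fromℚ q = mkℝ (λ _ → q) λ δ 0<δ →
  0 , λ _ _ _ _ → subst (_< δ) (sym (cong ∣_∣ (+-inverseʳ q))) 0<δ

0ᴿ : ℝ
0ᴿ = fromℚ 0ℚ

private
  ½*-pos : ∀ {δ} → 0ℚ < δ → 0ℚ < ½ * δ
  ½*-pos {δ} 0<δ = subst (_< ½ * δ) (*-zeroʳ ½) (*-monoʳ-<-pos ½ 0<δ)

  ½*+½* : ∀ δ → ½ * δ + ½ * δ ≡ δ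
  ½*+½* δ = trans (sym (*-distribʳ-+ δ ½ ½)) (*-identityˡ δ)

  +-cauchy : ∀ x y → IsCauchy x → IsCauchy y → IsCauchy (λ n → x n + y n)
  +-cauchy x y cx cy δ 0<δ with cx (½ * δ) (½*-pos 0<δ) | cy (½ * δ) (½*-pos 0<δ)
  ... | M , hx | N , hy = M ⊔ N , λ m n M⊔N≤m M⊔N≤n → begin-strict
      ∣ (x m + y m) - (x n + y n) ∣
        ≡⟨ cong ∣_∣ (rearrange (x m) (y m) (x n) (y n)) ⟩
      ∣ (x m - x n) + (y m - y n) ∣
        ≤⟨ ∣p+q∣≤∣p∣+∣q∣ (x m - x n) (y m - y n) ⟩
      ∣ x m - x n ∣ + ∣ y m - y n ∣
        <⟨ +-mono-< (hx m n (ℕ.m⊔n≤o⇒m≤o M N M⊔N≤m) (ℕ.m⊔n≤o⇒m≤o M N M⊔N≤n))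
                    (hy m n (ℕ.m⊔n≤o⇒n≤o M N M⊔N≤m) (ℕ.m⊔n≤o⇒n≤o M N M⊔N≤n)) ⟩
      ½ * δ + ½ * δ
        ≡⟨ ½*+½* δ ⟩
      δ ∎
    where
    open ≤-Reasoning
    open +-*-Solver
    rearrange : ∀ a b c d → (a + b) - (c + d) ≡ (a - c) + (b - d)
    rearrange = solve 4 (λ a b c d → (a :+ b) :+ (:- (c :+ d)) := (a :+ (:- c)) :+ (b :+ (:- d))) refl

  eventually-bounded : ∀ x → IsCauchy x →
    Σ[ B ∈ ℚ ] 0ℚ < B × Σ[ N ∈ ℕ ] (∀ n → N ℕ.≤ n → ∣ x n ∣ ≤ B)
  eventually-bounded x cx with cx 1ℚ (positive⁻¹ 1ℚ)
  ... | N , hx = 1ℚ + ∣ x N ∣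
               , +-mono-<-≤ (positive⁻¹ 1ℚ) (0≤∣p∣ (x N))
               , N , λ n N≤n → begin
      ∣ x n ∣                  ≡⟨ cong ∣_∣ (split (x n) (x N)) ⟩
      ∣ (x n - x N) + x N ∣    ≤⟨ ∣p+q∣≤∣p∣+∣q∣ (x n - x N) (x N) ⟩
      ∣ x n - x N ∣ + ∣ x N ∣  ≤⟨ +-monoˡ-≤ ∣ x N ∣ (<⇒≤ (hx n N N≤n ℕ.≤-refl)) ⟩
      1ℚ + ∣ x N ∣             ∎
    where
    open ≤-Reasoning
    open +-*-Solver
    split : ∀ a b → a ≡ (a - b) + b
    split = solve 2 (λ a b → a := (a :+ (:- b)) :+ b) refl

  -- Every positive B has a positive η with B * η ≡ ½ * δ.
  divide : ∀ B δ → 0ℚ < B → 0ℚ < δ → Σ[ η ∈ ℚ ] 0ℚ < η × B * η ≡ ½ * δ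
  divide B δ 0<B 0<δ = 1/ B * (½ * δ)
    , subst (_< 1/ B * (½ * δ)) (*-zeroʳ (1/ B)) (*-monoʳ-<-pos (1/ B) (½*-pos 0<δ))
    , trans (sym (*-assoc B (1/ B) (½ * δ)))
        (trans (cong (_* (½ * δ)) (*-inverseʳ B)) (*-identityˡ (½ * δ)))
    where
    instance
      B-pos : Positive B
      B-pos = positive 0<B
      B-nonZero : ℚ.NonZero B
      B-nonZero = pos⇒nonZero B
      1/B-pos : Positive (1/ B)
      1/B-pos = 1/pos⇒pos B

  ∣*∣-bound : ∀ {B η} p q → 0ℚ < B → ∣ p ∣ ≤ B → ∣ q ∣ < η → ∣ p * q ∣ < B * η
  ∣*∣-bound {B} {η} p q 0<B p≤B q<η = begin-strict
      ∣ p * q ∣      ≡⟨ ∣p*q∣≡∣p∣*∣q∣ p q ⟩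
      ∣ p ∣ * ∣ q ∣  ≤⟨ *-monoʳ-≤-nonNeg ∣ q ∣ {{∣-∣-nonNeg q}} p≤B ⟩
      B * ∣ q ∣      <⟨ *-monoʳ-<-pos B {{positive 0<B}} q<η ⟩
      B * η          ∎
    where open ≤-Reasoning

  *-cauchy-step : ∀ (x y : ℕ → ℚ) {A B η θ δ} K L M N → 0ℚ < A → 0ℚ < B →
    A * η ≡ ½ * δ → B * θ ≡ ½ * δ →
    (∀ n → K ℕ.≤ n → ∣ x n ∣ ≤ A) →
    (∀ n → L ℕ.≤ n → ∣ y n ∣ ≤ B) →
    (∀ m n → M ℕ.≤ m → M ℕ.≤ n → ∣ x m - x n ∣ < θ) →
    (∀ m n → N ℕ.≤ m → N ℕ.≤ n → ∣ y m - y n ∣ < η) →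
    ∀ m n → (K ⊔ L) ⊔ (M ⊔ N) ℕ.≤ m → (K ⊔ L) ⊔ (M ⊔ N) ℕ.≤ n →
    ∣ x m * y m - x n * y n ∣ < δ
  *-cauchy-step x y {A} {B} {η} {θ} {δ} K L M N
    0<A 0<B Aη Bθ bx by hx hy m n ≤m ≤n = begin-strict
      ∣ x m * y m - x n * y n ∣
        ≡⟨ cong ∣_∣ (rearrange (x m) (y m) (x n) (y n)) ⟩
      ∣ x m * (y m - y n) + y n * (x m - x n) ∣
        ≤⟨ ∣p+q∣≤∣p∣+∣q∣ (x m * (y m - y n)) (y n * (x m - x n)) ⟩
      ∣ x m * (y m - y n) ∣ + ∣ y n * (x m - x n) ∣
        <⟨ +-mono-<
             (∣*∣-bound (x m) (y m - y n) 0<A (bx m K≤m) (hy m n N≤m N≤n))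
             (∣*∣-bound (y n) (x m - x n) 0<B (by n L≤n) (hx m n M≤m M≤n)) ⟩
      A * η + B * θ
        ≡⟨ cong₂ _+_ Aη Bθ ⟩
      ½ * δ + ½ * δ
        ≡⟨ ½*+½* δ ⟩
      δ ∎
    where
    open ≤-Reasoning
    open +-*-Solver
    K⊔L≤m = ℕ.m⊔n≤o⇒m≤o (K ⊔ L) (M ⊔ N) ≤m
    M⊔N≤m = ℕ.m⊔n≤o⇒n≤o (K ⊔ L) (M ⊔ N) ≤m
    K⊔L≤n = ℕ.m⊔n≤o⇒m≤o (K ⊔ L) (M ⊔ N) ≤n
    M⊔N≤n = ℕ.m⊔n≤o⇒n≤o (K ⊔ L) (M ⊔ N) ≤n
    K≤m = ℕ.m⊔n≤o⇒m≤o K L K⊔L≤m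
    L≤n = ℕ.m⊔n≤o⇒n≤o K L K⊔L≤n
    M≤m = ℕ.m⊔n≤o⇒m≤o M N M⊔N≤m
    M≤n = ℕ.m⊔n≤o⇒m≤o M N M⊔N≤n
    N≤m = ℕ.m⊔n≤o⇒n≤o M N M⊔N≤m
    N≤n = ℕ.m⊔n≤o⇒n≤o M N M⊔N≤n
    rearrange : ∀ a b c d → a * b - c * d ≡ a * (b - d) + d * (a - c)
    rearrange = solve 4 (λ a b c d →
      (a :* b) :+ (:- (c :* d)) := (a :* (b :+ (:- d))) :+ (d :* (a :+ (:- c)))) refl

  *-cauchy : ∀ x y → IsCauchy x → IsCauchy y → IsCauchy (λ n → x n * y n)
  *-cauchy x y cx cy δ 0<δ =
    let A , 0<A , K , bx = eventually-bounded x cx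
        B , 0<B , L , by = eventually-bounded y cy
        η , 0<η , Aη     = divide A δ 0<A 0<δ
        θ , 0<θ , Bθ     = divide B δ 0<B 0<δ
        M , hx           = cx θ 0<θ
        N , hy           = cy η 0<η
    in (K ⊔ L) ⊔ (M ⊔ N) , *-cauchy-step x y K L M N 0<A 0<B Aη Bθ bx by hx hy

_+ᴿ_ : ℝ → ℝ → ℝ
x +ᴿ y = mkℝ (λ n → seq x n + seq y n) (+-cauchy (seq x) (seq y) (cauchy x) (cauchy y))

_*ᴿ_ : ℝ → ℝ → ℝ
x *ᴿ y = mkℝ (λ n → seq x n * seq y n) (*-cauchy (seq x) (seq y) (cauchy x) (cauchy y))

∑ : ∀ {d} → Vector ℝ d → ℝ
∑ = foldr _+ᴿ_ 0ᴿ

------------------------------------------------------------------------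
-- Parametric graphs

record ParamGraph (d n : ℕ) : Set where
  field
    adj : Fin n → Fin n → Bool

  Edge : Fin n → Fin n → Set
  Edge u v = T (adj u v)

  field
    loopless  : ∀ u → ¬ Edge u u
    -- Connectedness of the underlying undirected graph.
    connected : ∀ u v → EqClosure Edge u v
    source    : Fin n
    sink      : Fin n
    -- Entries 0, …, d-1 multiply the parameters; entry d is the constant term.
    coeff     : ∀ u v → Edge u v → Vector ℝ (suc d)

  edgeWeight : Vector ℝ d → ∀ u v → Edge u v → ℝ
  edgeWeight x u v e =
    ∑ (λ i → coeff u v e (inject₁ i) *ᴿ x i) +ᴿ coeff u v e (fromℕ d)

  Walk : Fin n → Fin n → Set
  Walk = Star Edge

  vertices : ∀ {u v} → Walk u v → List (Fin n)
  vertices {u} ε       = u ∷ []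
  vertices {u} (_ ◅ p) = u ∷ vertices p

  weight : Vector ℝ d → ∀ {u v} → Walk u v → ℝ
  weight x ε = 0ᴿ
  weight x {u} (_◅_ {j = v} e p) = edgeWeight x u v e +ᴿ weight x p

  IsPath : ∀ {u v} → Walk u v → Set
  IsPath p = Unique (vertices p)

  Acyclic : Set
  Acyclic = ∀ v → ¬ TransClosure Edge v v

  IsShortest : Vector ℝ d → Walk source sink → Set
  IsShortest x p = IsPath p × (∀ (q : Walk source sink) → IsPath q → weight x p ≤ᴿ weight x q)

  -- A finite set of source-sink paths is a duplicate-free list.  The double
  -- negation makes this the classical notion: over constructive reals one
  -- cannot in general decide which of two paths is the shorter.
  record IsCover (S : List (Walk source sink)) : Set where
    field
      distinct : Unique S
      paths    : All IsPath S
      covers   : ∀ x → ¬ ¬ (∃[ p ] (p ∈ S × IsShortest x p))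

  record IsMSPC (S : List (Walk source sink)) : Set where
    field
      isCover : IsCover S
      minimum : ∀ S′ → IsCover S′ → length S ℕ.≤ length S′

------------------------------------------------------------------------
-- n ^ (c · d · log₂ n) ≤ m for c = 1 / k, that is n ^ (d · log₂ n) ≤ m ^ k.
-- The real exponent is the supremum of the rationals q / p ≤ log₂ n, i.e.
-- those with 2 ^ q ≤ n ^ p, and n ^ (d · q / p) ≤ m ^ k has been raised to
-- the power p.

PowLogBound : (n d k m : ℕ) → Set
PowLogBound n d k m =
  ∀ p q → 0 ℕ.< p → 2 ℕ.^ q ℕ.≤ n ℕ.^ p → n ℕ.^ (d ℕ.* q) ℕ.≤ m ℕ.^ (k ℕ.* p)

{-# OPTIONS --safe #-}
-- For one parameter, build recursively a block of 2ᵐ - 1 layers, with small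
-- integers as states, and Aᵐ integers λ whose optimal routes π are distinct;
-- the state v after the block only translates the optimum to v + π.  To pass
-- to m + 1, put a new vertex u between a copy of the block and a reversed,
-- negated copy.  Scaled up heavily, the copies force the routes u + π and
-- u - π, at a cost that does not depend on u.  A perturbation of lower order,
-- antisymmetric in the two copies, is then a multiple of λu, and can be chosen
-- such that the optimal u is the next base-A digit of the parameter.
--
-- Blocks in series with separate parameters multiply the numbers of optimal
-- routes: d blocks give A ^ (d m) parameter vectors, each with a single
-- shortest path, and these paths are distinct.  With A = 2ᵐ the graph has at
-- most 2 ^ 5m vertices once m ≥ d + 2, while 2 ^ (d m²) paths are needed.
module Submission where

open import Defs
open import Data.Bool.Base using (Bool; T; if_then_else_)
open import Data.Bool.Properties using (T-irrelevant; T?)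
open import Data.Fin.Base using (Fin; zero; suc; inject₁; fromℕ; fromℕ<; toℕ)
import Data.Fin.Properties as Fin
open import Data.Integer.Base as ℤ using (ℤ; 0ℤ; 1ℤ)
import Data.Integer.Properties as ℤ
open import Data.List.Base using (length)
open import Data.Nat.Base as ℕ using (ℕ; zero; suc; z≤n; s≤s; NonZero)
import Data.Nat.Properties as ℕ
open import Data.Product.Base using (Σ-syntax; ∃-syntax; _×_; _,_)
open import Data.Sum.Base using (_⊎_; inj₁; inj₂)
open import Data.Vec.Functional using (Vector; foldr)
open import Function.Base using (_∘_)
open import Relation.Binary.PropositionalEquality
open import Relation.Nullary using (¬_; yes; no; contradiction)

-- The bound counts vertices, not the size of the weights. Each doubling may therefore use a scale
-- far above all earlier ones, while the states grow by only one digit per level; this keeps the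
-- layers narrow. The copies cost the same for every `u` because the least energy of a block
-- followed by the state `v` is a constant, minus `v` squared, minus a multiple of `v`. The negated
-- copy is followed by `- u`, so the linear terms cancel, and the two squares are paid back by the
-- price of the new vertex. The perturbation is a multiple of `λu` because a fixed linear functional
-- `pos` takes the value λ on the optimal route `π`: the squares weighted by its coefficients differ
-- by `4 u pos π` between the translates of `π` by `u` and by `- u`. All energies are integers, so
-- leaving a route costs at least 1. This gap is what the next scale multiplies, and in the end it
-- makes the shortest paths unique. A cover has to contain each of them, even though covering is
-- stated under a double negation, since membership in a list of walks is decidable.

-- Integer energies of chains of layers and their unique minimisers.

module Chains where

  open import Algebra.Properties.AbelianGroup ℤ.+-0-abelianGroup using (∙-cancelˡ)
  open import Data.Integer.Base using (+_; _+_; _*_; _-_; -_; ∣_∣; _≤_)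
  open import Data.Integer.Tactic.RingSolver using (solve-∀)
  open import Data.Nat.Base using (_∸_)
  import Data.Nat.Tactic.RingSolver as ℕ-Solver
  open import Relation.Binary.Definitions using (tri<; tri≈; tri>)

  -- Finite sums

  opaque

    ∑< : ℕ → (ℕ → ℤ) → ℤ
    ∑< zero    f = 0ℤ
    ∑< (suc n) f = f 0 + ∑< n (f ∘ suc)

    ∑-empty : ∀ f → ∑< 0 f ≡ 0ℤ
    ∑-empty f = refl

    ∑-first : ∀ n f → ∑< (suc n) f ≡ f 0 + ∑< n (f ∘ suc)
    ∑-first n f = refl

    ∑-cong : ∀ n {f g : ℕ → ℤ} → (∀ i → i ℕ.< n → f i ≡ g i) → ∑< n f ≡ ∑< n g
    ∑-cong zero    f≗g = refl
    ∑-cong (suc n) f≗g = cong₂ _+_ (f≗g 0 (s≤s z≤n)) (∑-cong n λ i i<n → f≗g (suc i) (s≤s i<n))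

    ∑-linear : ∀ n a b f g → ∑< n (λ i → a * f i + b * g i) ≡ a * ∑< n f + b * ∑< n g
    ∑-linear zero    a b f g = sym (trans (cong₂ _+_ (ℤ.*-zeroʳ a) (ℤ.*-zeroʳ b)) refl)
    ∑-linear (suc n) a b f g =
      trans (cong (λ s → a * f 0 + b * g 0 + s) (∑-linear n a b (f ∘ suc) (g ∘ suc)))
            (lemma a b (f 0) (g 0) (∑< n (f ∘ suc)) (∑< n (g ∘ suc)))
      where
      lemma : ∀ a b x y s t → a * x + b * y + (a * s + b * t) ≡ a * (x + s) + b * (y + t)
      lemma = solve-∀

    ∑-*ˡ : ∀ n a f → ∑< n (λ i → a * f i) ≡ a * ∑< n f
    ∑-*ˡ zero    a f = sym (ℤ.*-zeroʳ a)
    ∑-*ˡ (suc n) a f = trans (cong (_+_ (a * f 0)) (∑-*ˡ n a (f ∘ suc))) (sym (ℤ.*-distribˡ-+ a (f 0) _))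

    ∑-last : ∀ n f → ∑< (suc n) f ≡ ∑< n f + f n
    ∑-last zero    f = ℤ.+-comm (f 0) 0ℤ
    ∑-last (suc n) f = trans (cong (_+_ (f 0)) (∑-last n (f ∘ suc))) (sym (ℤ.+-assoc (f 0) _ _))

    ∑-split : ∀ m n f → ∑< (m ℕ.+ n) f ≡ ∑< m f + ∑< n (λ i → f (m ℕ.+ i))
    ∑-split zero    n f = sym (ℤ.+-identityˡ _)
    ∑-split (suc m) n f = trans (cong (_+_ (f 0)) (∑-split m n (f ∘ suc))) (sym (ℤ.+-assoc (f 0) _ _))

    ∑-reverse : ∀ n f → ∑< n (λ i → f (n ∸ suc i)) ≡ ∑< n f
    ∑-reverse zero    f = refl
    ∑-reverse (suc n) f = begin
      f n + ∑< n (λ i → f (n ∸ suc i))  ≡⟨ cong (_+_ (f n)) (∑-reverse n f) ⟩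
      f n + ∑< n f                      ≡⟨ ℤ.+-comm (f n) _ ⟩
      ∑< n f + f n                      ≡⟨ ∑-last n f ⟨
      ∑< (suc n) f                      ∎
      where open ≡-Reasoning

    suc-∸ : ∀ {i n} → i ℕ.< n → suc (n ∸ suc i) ≡ n ∸ i
    suc-∸ {zero}  (s≤s _)   = refl
    suc-∸ {suc i} (s≤s i<n) = suc-∸ i<n

    ∑-mirror : ∀ n f → ∑< (suc (n ℕ.+ n)) f ≡ ∑< n f + f n + ∑< n (λ i → f (n ℕ.+ n ∸ i))
    ∑-mirror n f = begin
      ∑< (suc (n ℕ.+ n)) f
        ≡⟨ cong (λ k → ∑< k f) (ℕ.+-suc n n) ⟨
      ∑< (n ℕ.+ suc n) f
        ≡⟨ ∑-split n (suc n) f ⟩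
      ∑< n f + (f (n ℕ.+ 0) + ∑< n (λ i → f (n ℕ.+ suc i)))
        ≡⟨ ℤ.+-assoc (∑< n f) _ _ ⟨
      ∑< n f + f (n ℕ.+ 0) + ∑< n (λ i → f (n ℕ.+ suc i))
        ≡⟨ cong₂ (λ x y → ∑< n f + x + y) (cong f (ℕ.+-identityʳ n))
             (trans (sym (∑-reverse n (λ i → f (n ℕ.+ suc i))))
                    (∑-cong n λ i i<n → cong f (index i i<n))) ⟩
      ∑< n f + f n + ∑< n (λ i → f (n ℕ.+ n ∸ i)) ∎
      where
      open ≡-Reasoning
      index : ∀ i → i ℕ.< n → n ℕ.+ suc (n ∸ suc i) ≡ n ℕ.+ n ∸ i
      index i i<n = trans (cong (n ℕ.+_) (suc-∸ i<n)) (sym (ℕ.+-∸-assoc n (ℕ.<⇒≤ i<n)))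

  opaque
    unfolding ∑<

    ∑∣_∣< : (ℕ → ℤ) → ℕ → ℕ
    ∑∣ c ∣< zero    = 0
    ∑∣ c ∣< (suc n) = ∣ c 0 ∣ ℕ.+ ∑∣ c ∘ suc ∣< n

    ∑-bounded : ∀ n c (y : ℕ → ℤ) B → (∀ i → ∣ y i ∣ ℕ.≤ B) → ∣ ∑< n (λ i → c i * y i) ∣ ℕ.≤ ∑∣ c ∣< n ℕ.* B
    ∑-bounded zero    c y B ∣y∣≤B = z≤n
    ∑-bounded (suc n) c y B ∣y∣≤B = begin
      ∣ c 0 * y 0 + rest ∣            ≤⟨ ℤ.∣i+j∣≤∣i∣+∣j∣ (c 0 * y 0) rest ⟩
      ∣ c 0 * y 0 ∣ ℕ.+ ∣ rest ∣      ≡⟨ cong (ℕ._+ ∣ rest ∣) (ℤ.abs-* (c 0) (y 0)) ⟩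
      ∣ c 0 ∣ ℕ.* ∣ y 0 ∣ ℕ.+ ∣ rest ∣
        ≤⟨ ℕ.+-mono-≤ (ℕ.*-monoʳ-≤ ∣ c 0 ∣ (∣y∣≤B 0)) (∑-bounded n (c ∘ suc) (y ∘ suc) B (∣y∣≤B ∘ suc)) ⟩
      ∣ c 0 ∣ ℕ.* B ℕ.+ ∑∣ c ∘ suc ∣< n ℕ.* B
        ≡⟨ ℕ.*-distribʳ-+ B ∣ c 0 ∣ _ ⟨
      ∑∣ c ∣< (suc n) ℕ.* B ∎
      where
      open ℕ.≤-Reasoning
      rest : ℤ
      rest = ∑< n (λ i → c (suc i) * y (suc i))

  ∑-shift : ∀ n (c : ℕ → ℤ) u (π y : ℕ → ℤ) → (∀ i → i ℕ.< n → y i ≡ u + π i) →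
    ∑< n (λ i → c i * y i) ≡ u * ∑< n c + ∑< n (λ i → c i * π i)
  ∑-shift n c u π y y≗ = trans
    (trans (∑-cong n λ i i<n → trans (cong (c i *_) (y≗ i i<n)) (lemma (c i) u (π i)))
           (∑-linear n u 1ℤ c (λ i → c i * π i)))
    (cong (_+_ (u * ∑< n c)) (ℤ.*-identityˡ _))
    where
    lemma : ∀ c u x → c * (u + x) ≡ u * c + 1ℤ * (c * x)
    lemma = solve-∀

  -- The middle term is the useful one: it alone is odd in `u`, hence all that survives in the
  -- difference of the translates by `u` and by `- u`.
  ∑-shift² : ∀ n (c : ℕ → ℤ) u (π y : ℕ → ℤ) → (∀ i → i ℕ.< n → y i ≡ u + π i) →
    ∑< n (λ i → c i * (y i * y i)) ≡
    u * u * ∑< n c + + 2 * u * ∑< n (λ i → c i * π i) + ∑< n (λ i → c i * (π i * π i))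
  ∑-shift² n c u π y y≗ = begin
    ∑< n (λ i → c i * (y i * y i))
      ≡⟨ ∑-cong n (λ i i<n → trans (cong (λ z → c i * (z * z)) (y≗ i i<n)) (lemma (c i) u (π i))) ⟩
    ∑< n (λ i → u * (u * c i + + 2 * (c i * π i)) + 1ℤ * (c i * (π i * π i)))
      ≡⟨ ∑-linear n u 1ℤ (λ i → u * c i + + 2 * (c i * π i)) (λ i → c i * (π i * π i)) ⟩
    u * ∑< n (λ i → u * c i + + 2 * (c i * π i)) + 1ℤ * ∑< n (λ i → c i * (π i * π i))
      ≡⟨ cong (λ s → u * s + 1ℤ * ∑< n (λ i → c i * (π i * π i))) (∑-linear n u (+ 2) c (λ i → c i * π i)) ⟩
    u * (u * ∑< n c + + 2 * ∑< n (λ i → c i * π i)) + 1ℤ * ∑< n (λ i → c i * (π i * π i))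
      ≡⟨ lemma′ u (∑< n c) _ _ ⟩
    u * u * ∑< n c + + 2 * u * ∑< n (λ i → c i * π i) + ∑< n (λ i → c i * (π i * π i)) ∎
    where
    open ≡-Reasoning
    lemma : ∀ c u x → c * ((u + x) * (u + x)) ≡ u * (u * c + + 2 * (c * x)) + 1ℤ * (c * (x * x))
    lemma = solve-∀
    lemma′ : ∀ u c s t → u * (u * c + + 2 * s) + 1ℤ * t ≡ u * u * c + + 2 * u * s + t
    lemma′ = solve-∀

  -- Sequences f 0, …, f (L - 1), c, g (L - 1), …, g 0

  opaque

    glue : {A : Set} → ℕ → (ℕ → A) → A → (ℕ → A) → ℕ → A
    glue L f c g i with ℕ.<-cmp i L
    ... | tri< _ _ _ = f i
    ... | tri≈ _ _ _ = c
    ... | tri> _ _ _ = g (L ℕ.+ L ∸ i)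

  module _ {A : Set} (L : ℕ) (f : ℕ → A) (c : A) (g : ℕ → A) where

    opaque
      unfolding glue

      glue-left : ∀ i → i ℕ.< L → glue L f c g i ≡ f i
      glue-left i i<L with ℕ.<-cmp i L
      ... | tri< _ _ _   = refl
      ... | tri≈ i≮L _ _ = contradiction i<L i≮L
      ... | tri> i≮L _ _ = contradiction i<L i≮L

      glue-mid : glue L f c g L ≡ c
      glue-mid with ℕ.<-cmp L L
      ... | tri< _ L≢L _ = contradiction refl L≢L
      ... | tri≈ _ _ _   = refl
      ... | tri> _ L≢L _ = contradiction refl L≢L

      L<L+L∸i : ∀ i → i ℕ.< L → L ℕ.< L ℕ.+ L ∸ i
      L<L+L∸i i i<L = subst (L ℕ.<_) (sym (ℕ.+-∸-assoc L (ℕ.<⇒≤ i<L)))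
                        (ℕ.m<m+n L (ℕ.m<n⇒0<n∸m i<L))

      glue-right : ∀ i → i ℕ.< L → glue L f c g (L ℕ.+ L ∸ i) ≡ g i
      glue-right i i<L with ℕ.<-cmp (L ℕ.+ L ∸ i) L
      ... | tri< _ _ ≯  = contradiction (L<L+L∸i i i<L) ≯
      ... | tri≈ _ _ ≯  = contradiction (L<L+L∸i i i<L) ≯
      ... | tri> _ _ _  = cong g (ℕ.m∸[m∸n]≡n (ℕ.≤-trans (ℕ.<⇒≤ i<L) (ℕ.m≤m+n L L)))

      glue-elim : (P : ℕ → A → Set) →
        (∀ i → i ℕ.< L → P i (f i)) → P L c → (∀ i → i ℕ.< L → P (L ℕ.+ L ∸ i) (g i)) →
        ∀ i → i ℕ.< suc (L ℕ.+ L) → P i (glue L f c g i)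
      glue-elim P pf pc pg i i≤2L with ℕ.<-cmp i L
      ... | tri< i<L _ _  = pf i i<L
      ... | tri≈ _ refl _ = pc
      ... | tri> _ _ L<i  =
        subst (λ k → P k (g (L ℕ.+ L ∸ i))) (ℕ.m∸[m∸n]≡n (ℕ.≤-pred i≤2L))
              (pg (L ℕ.+ L ∸ i) (subst (L ℕ.+ L ∸ i ℕ.<_) (ℕ.m+n∸n≡m L L) (ℕ.∸-monoʳ-< L<i (ℕ.≤-pred i≤2L))))

    opaque
      unfolding glue

      glue-all : (P : A → Set) → (∀ i → P (f i)) → P c → (∀ i → P (g i)) → ∀ i → P (glue L f c g i)
      glue-all P pf pc pg i with ℕ.<-cmp i L
      ... | tri< _ _ _ = pf i
      ... | tri≈ _ _ _ = pc
      ... | tri> _ _ _ = pg (L ℕ.+ L ∸ i)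

  -- Blocks of layers

  -- A block prices the states y 0, …, y (size - 1) of consecutive layers at the
  -- parameter λ by quad y - 2λ · lin y.  The last summand of quad couples the
  -- block to the state y size of the layer after it.  The coefficients ρ
  -- do not enter the price: pos reads off λ from an optimal route, and double
  -- uses them to couple a route to λ.
  record Block : Set where
    field
      pred-length : ℕ
      α γ σ ρ     : ℕ → ℤ

    size : ℕ
    size = suc pred-length

    quad lin pos sq : (ℕ → ℤ) → ℤ
    quad y = ∑< size (λ i → α i * (y i * y i)) + ∑< size (λ i → γ i * (y i * y (suc i)))
    lin  y = ∑< size (λ i → σ i * y i)
    pos  y = ∑< size (λ i → ρ i * y i)
    sq   y = ∑< size (λ i → ρ i * (y i * y i))

    ∑ρ : ℤ
    ∑ρ = ∑< size ρ

    energy : ℤ → (ℕ → ℤ) → ℤ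
    energy λ′ y = quad y - + 2 * λ′ * lin y

  open Block public

  unit : Block
  unit = record { pred-length = 0 ; α = λ _ → 1ℤ ; γ = λ _ → - (+ 2) ; σ = λ _ → 1ℤ ; ρ = λ _ → 1ℤ }

  -- Doubling a block.

  module Double (κ : ℤ) (B : Block) where

    private
      L = size B
      K = + 2 * κ

      αˡ αʳ γˡ γʳ σˡ σʳ ρˡ ρʳ : ℕ → ℤ
      αˡ i = K * K * α B i + κ * ρ B i
      αʳ i = K * K * α B i + - κ * ρ B i
      γˡ i = K * K * γ B i
      -- Position 0 of the reversed copy is the last layer of the doubled block and couples to the
      -- next state as in `unit`. A coupling between positions `i` and `suc i` is stored at `suc i`,
      -- which is traversed first; hence the shift, and `γʳ L` at the new vertex.
      γʳ zero    = - (+ 2)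
      γʳ (suc i) = K * K * γ B i
      σˡ i = K * σ B i
      σʳ i = - K * σ B i
      ρˡ i = K * ρ B i
      ρʳ i = 0ℤ

      αᵐ ρᵐ : ℤ
      -- The first summand offsets `- u * u` in the least energies of both copies; the second leaves
      -- the square that selects `u`.
      αᵐ = + 2 * (K * K) + 1ℤ
      ρᵐ = 1ℤ - K * ∑ρ B

    -- Two copies of B around a new vertex u.  The factors K², K and 1 separate
    -- three scales: leaving a route inside a copy, the linear terms, and the
    -- choice of u.  On the routes u + π and u - π the terms ± κρ contribute
    -- κ Σ ρ ((u + π)² - (u - π)²) = 2Kλu, which offsets the share of Kλ in the
    -- cost - 2 (Kλ + b) u + u² of u, so that u = b is optimal.
    double : Block
    double = record
      { pred-length = L ℕ.+ L
      ; α = glue L αˡ αᵐ αʳ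
      ; γ = glue L γˡ (γʳ L) γʳ
      ; σ = glue L σˡ 1ℤ σʳ
      ; ρ = glue L ρˡ ρᵐ ρʳ
      }

    -- The states of the right copy, which is traversed backwards and negated.
    flip : (ℕ → ℤ) → ℕ → ℤ
    flip y i = - y (L ℕ.+ L ∸ i)

    pos-double : ∀ y → pos double y ≡ K * pos B y + (1ℤ - K * ∑ρ B) * y L
    pos-double y = begin
      pos double y
        ≡⟨ ∑-mirror L (λ i → ρ double i * y i) ⟩
      ∑< L (λ i → ρ double i * y i) + ρ double L * y L + ∑< L (λ i → ρ double (L ℕ.+ L ∸ i) * y (L ℕ.+ L ∸ i))
        ≡⟨ cong₂ _+_ (cong₂ _+_ left (cong (_* y L) (glue-mid L ρˡ ρᵐ ρʳ))) right ⟩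
      K * pos B y + (1ℤ - K * ∑ρ B) * y L + 0ℤ
        ≡⟨ ℤ.+-identityʳ _ ⟩
      K * pos B y + (1ℤ - K * ∑ρ B) * y L ∎
      where
      open ≡-Reasoning
      left = trans (∑-cong L λ i i<L → trans (cong (_* y i) (glue-left L ρˡ ρᵐ ρʳ i i<L)) (ℤ.*-assoc K (ρ B i) (y i)))
                   (∑-*ˡ L K (λ i → ρ B i * y i))
      right = trans (∑-cong L {g = λ i → 0ℤ * 0ℤ} λ i i<L →
                       cong (_* y (L ℕ.+ L ∸ i)) (glue-right L ρˡ ρᵐ ρʳ i i<L))
                    (∑-*ˡ L 0ℤ (λ _ → 0ℤ))

    lin-double : ∀ y → lin double y ≡ K * (lin B y + lin B (flip y)) + y L
    lin-double y = begin
      lin double y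
        ≡⟨ ∑-mirror L (λ i → σ double i * y i) ⟩
      ∑< L (λ i → σ double i * y i) + σ double L * y L + ∑< L (λ i → σ double (L ℕ.+ L ∸ i) * y (L ℕ.+ L ∸ i))
        ≡⟨ cong₂ _+_ (cong₂ _+_ left (cong (_* y L) (glue-mid L σˡ 1ℤ σʳ))) right ⟩
      K * lin B y + 1ℤ * y L + K * lin B (flip y)
        ≡⟨ rearrange K (lin B y) (lin B (flip y)) (y L) ⟩
      K * (lin B y + lin B (flip y)) + y L ∎
      where
      open ≡-Reasoning
      left = trans (∑-cong L λ i i<L → trans (cong (_* y i) (glue-left L σˡ 1ℤ σʳ i i<L)) (ℤ.*-assoc K (σ B i) (y i)))
                   (∑-*ˡ L K (λ i → σ B i * y i))
      neg : ∀ K s x → - K * s * x ≡ K * (s * - x)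
      neg = solve-∀
      right = trans (∑-cong L λ i i<L → trans (cong (_* y (L ℕ.+ L ∸ i)) (glue-right L σˡ 1ℤ σʳ i i<L))
                                              (neg K (σ B i) (y (L ℕ.+ L ∸ i))))
                    (∑-*ˡ L K (λ i → σ B i * flip y i))
      rearrange : ∀ K p r u → K * p + 1ℤ * u + K * r ≡ K * (p + r) + u
      rearrange = solve-∀

    quad-double : ∀ y → quad double y ≡
      K * K * (quad B y + quad B (flip y) + + 2 * (y L * y L))
        + κ * (sq B y - sq B (flip y)) + y L * y L + + 2 * flip y 0 * y (size double)
    quad-double y = trans (cong₂ _+_ α-part γ-part)
      (rearrange K κ (∑< L (λ i → α B i * (y i * y i))) (sq B y) (y L)
        (∑< L (λ i → α B i * (flip y i * flip y i))) (sq B (flip y))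
        (∑< L (λ i → γ B i * (y i * y (suc i)))) (∑< L (λ i → γ B i * (flip y i * flip y (suc i))))
        (flip y 0) (y (size double)))
      where
      open ≡-Reasoning
      rearrange : ∀ K κ a s u a′ s′ g g′ r v →
        K * K * a + κ * s + (+ 2 * (K * K) + 1ℤ) * (u * u) + (K * K * a′ + - κ * s′)
          + (K * K * g + (+ 2 * r * v + K * K * g′))
        ≡ K * K * (a + g + (a′ + g′) + + 2 * (u * u)) + κ * (s - s′) + u * u + + 2 * r * v
      rearrange = solve-∀
      dist : ∀ a b x y z → (a * x + b * y) * z ≡ a * (x * z) + b * (y * z)
      dist = solve-∀
      dist- : ∀ a b x y z → (a * x + b * y) * (z * z) ≡ a * (x * (- z * - z)) + b * (y * (- z * - z))
      dist- = solve-∀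
      α-part = begin
        ∑< (size double) (λ i → α double i * (y i * y i))
          ≡⟨ ∑-mirror L (λ i → α double i * (y i * y i)) ⟩
        ∑< L (λ i → α double i * (y i * y i)) + α double L * (y L * y L)
          + ∑< L (λ i → α double (L ℕ.+ L ∸ i) * (y (L ℕ.+ L ∸ i) * y (L ℕ.+ L ∸ i)))
          ≡⟨ cong₂ _+_ (cong₂ _+_
               (trans (∑-cong L λ i i<L →
                  trans (cong (_* (y i * y i)) (glue-left L αˡ αᵐ αʳ i i<L))
                        (dist (K * K) κ (α B i) (ρ B i) (y i * y i)))
                  (∑-linear L (K * K) κ (λ i → α B i * (y i * y i)) (λ i → ρ B i * (y i * y i))))
               (cong (_* (y L * y L)) (glue-mid L αˡ αᵐ αʳ)))
               (trans (∑-cong L λ i i<L →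
                  trans (cong (_* (y (L ℕ.+ L ∸ i) * y (L ℕ.+ L ∸ i))) (glue-right L αˡ αᵐ αʳ i i<L))
                        (dist- (K * K) (- κ) (α B i) (ρ B i) (y (L ℕ.+ L ∸ i))))
                  (∑-linear L (K * K) (- κ) (λ i → α B i * (flip y i * flip y i)) (λ i → ρ B i * (flip y i * flip y i)))) ⟩
        K * K * ∑< L (λ i → α B i * (y i * y i)) + κ * sq B y + (+ 2 * (K * K) + 1ℤ) * (y L * y L)
          + (K * K * ∑< L (λ i → α B i * (flip y i * flip y i)) + - κ * sq B (flip y)) ∎
      G : ℕ → ℤ
      G i = γ double i * (y i * y (suc i))
      γ-right : ∀ j → j ℕ.≤ L → γ double (L ℕ.+ L ∸ j) ≡ γʳ j
      γ-right j j≤L with ℕ.m≤n⇒m<n∨m≡n j≤L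
      ... | inj₁ j<L  = glue-right L γˡ (γʳ L) γʳ j j<L
      ... | inj₂ refl = trans (cong (γ double) (ℕ.m+n∸n≡m L L)) (glue-mid L γˡ (γʳ L) γʳ)
      G-right : ∀ i → i ℕ.< L →
        G (L ℕ.+ L ∸ suc i) ≡ K * K * (γ B i * (flip y i * flip y (suc i)))
      G-right i i<L = begin
        γ double (L ℕ.+ L ∸ suc i) * (y (L ℕ.+ L ∸ suc i) * y (suc (L ℕ.+ L ∸ suc i)))
          ≡⟨ cong₂ (λ g z → g * (y (L ℕ.+ L ∸ suc i) * y z)) (γ-right (suc i) i<L) (suc-∸ (ℕ.<-≤-trans i<L (ℕ.m≤m+n L L))) ⟩
        K * K * γ B i * (y (L ℕ.+ L ∸ suc i) * y (L ℕ.+ L ∸ i))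
          ≡⟨ swap (K * K) (γ B i) (y (L ℕ.+ L ∸ suc i)) (y (L ℕ.+ L ∸ i)) ⟩
        K * K * (γ B i * (flip y i * flip y (suc i))) ∎
        where
        swap : ∀ k g x z → k * g * (x * z) ≡ k * (g * (- z * - x))
        swap = solve-∀
      last : - (+ 2) * (y (L ℕ.+ L) * y (size double)) ≡ + 2 * flip y 0 * y (size double)
      last = l (y (L ℕ.+ L)) (y (size double))
        where
        l : ∀ x v → - (+ 2) * (x * v) ≡ + 2 * - x * v
        l = solve-∀
      γ-part = begin
        ∑< (size double) G
          ≡⟨ ∑-mirror L G ⟩
        ∑< L G + G L + ∑< L (λ i → G (L ℕ.+ L ∸ i))
          ≡⟨ ℤ.+-assoc (∑< L G) (G L) _ ⟩
        ∑< L G + (G L + ∑< L (λ i → G (L ℕ.+ L ∸ i)))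
          -- Here `L + 1` couplings remain. Regrouped, that of the new vertex joins the right copy,
          -- and that of the very last layer, which points out of the block, splits off.
          ≡⟨ cong (_+_ (∑< L G)) (trans (ℤ.+-comm (G L) (∑< L (λ i → G (L ℕ.+ L ∸ i))))
               (trans (cong (λ z → ∑< L (λ i → G (L ℕ.+ L ∸ i)) + G z) (sym (ℕ.m+n∸n≡m L L)))
                      (trans (sym (∑-last L (λ i → G (L ℕ.+ L ∸ i))))
                             (∑-first L (λ i → G (L ℕ.+ L ∸ i)))))) ⟩
        ∑< L G + (G (L ℕ.+ L) + ∑< L (λ i → G (L ℕ.+ L ∸ suc i)))
          ≡⟨ cong₂ _+_
               (trans (∑-cong L λ i i<L →
                  trans (cong (_* (y i * y (suc i))) (glue-left L γˡ (γʳ L) γʳ i i<L)) (ℤ.*-assoc (K * K) (γ B i) (y i * y (suc i))))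
                  (∑-*ˡ L (K * K) (λ i → γ B i * (y i * y (suc i)))))
               (cong₂ _+_
                 (trans (cong (_* (y (L ℕ.+ L) * y (size double))) (γ-right 0 z≤n)) last)
                 (trans (∑-cong L G-right) (∑-*ˡ L (K * K) (λ i → γ B i * (flip y i * flip y (suc i)))))) ⟩
        K * K * ∑< L (λ i → γ B i * (y i * y (suc i)))
          + (+ 2 * flip y 0 * y (size double)
          + K * K * ∑< L (λ i → γ B i * (flip y i * flip y (suc i)))) ∎

  1≤i*i : ∀ i → i ≢ 0ℤ → 1ℤ ≤ i * i
  1≤i*i (+ zero)     i≢0 = contradiction refl i≢0
  1≤i*i (+ suc n)    i≢0 = ℤ.+≤+ (s≤s z≤n)
  1≤i*i ℤ.-[1+ n ]   i≢0 = ℤ.+≤+ (s≤s z≤n)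

  -- The optimal route of a block is translated by the state after the block.
  Follows : Block → (ℕ → ℤ) → (ℕ → ℤ) → Set
  Follows B π y = ∀ i → i ℕ.< size B → y i ≡ y (size B) + π i

  ∣+∣≤ : ∀ {i j m n} → ∣ i ∣ ℕ.≤ m → ∣ j ∣ ℕ.≤ n → ∣ i + j ∣ ℕ.≤ m ℕ.+ n
  ∣+∣≤ {i} {j} i≤m j≤n = ℕ.≤-trans (ℤ.∣i+j∣≤∣i∣+∣j∣ i j) (ℕ.+-mono-≤ i≤m j≤n)

  ∣-∣≤ : ∀ {i j m n} → ∣ i ∣ ℕ.≤ m → ∣ j ∣ ℕ.≤ n → ∣ i - j ∣ ℕ.≤ m ℕ.+ n
  ∣-∣≤ {i} {j} i≤m j≤n = ℕ.≤-trans (ℤ.∣i-j∣≤∣i∣+∣j∣ i j) (ℕ.+-mono-≤ i≤m j≤n)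

  ∣*∣≤ : ∀ {i j m n} → ∣ i ∣ ℕ.≤ m → ∣ j ∣ ℕ.≤ n → ∣ i * j ∣ ℕ.≤ m ℕ.* n
  ∣*∣≤ {i} {j} i≤m j≤n = ℕ.≤-trans (ℕ.≤-reflexive (ℤ.abs-* i j)) (ℕ.*-mono-≤ i≤m j≤n)

  ∣neg∣≤ : ∀ {i m} → ∣ i ∣ ℕ.≤ m → ∣ - i ∣ ℕ.≤ m
  ∣neg∣≤ {i} i≤m = ℕ.≤-trans (ℕ.≤-reflexive (ℤ.∣-i∣≡∣i∣ i)) i≤m

  i≤+∣i∣ : ∀ i → i ≤ + ∣ i ∣
  i≤+∣i∣ (+ n)      = ℤ.≤-refl
  i≤+∣i∣ ℤ.-[1+ n ] = ℤ.-≤+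

  -- R bounds the absolute values of all states.
  module Hierarchy (R : ℕ) where

    ∥σ∥ ∥ρ∥ scale : Block → ℕ
    ∥σ∥ B = ∑∣ σ B ∣< (size B)
    ∥ρ∥ B = ∑∣ ρ B ∣< (size B)
    -- Four times the first factor dominates the constants `16 ∥σ∥ + 6 ∥ρ∥` and 11 in the bounds on
    -- the two parts of `δ`, so that `K * K`, which is four times the square of the scale, exceeds
    -- `δ`. The final 1 covers `R = 0`.
    scale B = (4 ℕ.* ∥σ∥ B ℕ.+ 2 ℕ.* ∥ρ∥ B ℕ.+ 11) ℕ.* (R ℕ.* R) ℕ.+ 1

    level : ℕ → Block
    level zero    = unit
    level (suc m) = Double.double (+ scale (level m)) (level m)

    module _ (a : ℕ → ℕ) where

      -- A mixed-radix number with radix `K` at each level: the leading part steers the two copies,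
      -- the last digit the new vertex.
      param : ℕ → ℤ
      param zero    = + a 0
      param (suc m) = + 2 * + scale (level m) * param m + + a (suc m)

      route : ℕ → ℕ → ℤ
      route zero    i = + a 0
      route (suc m) = glue (size (level m)) (λ i → + a (suc m) + route m i) (+ a (suc m))
                                              (λ i → + a (suc m) - route m i)

      -- The recursion adds up two copies at their minima, the constant that `- 2bK (lin y + lin r)`
      -- becomes on the routes, and `- b * b` from completing the square in `u`.
      value : ℕ → ℤ
      value zero    = - (+ a 0 * + a 0)
      value (suc m) = + 2 * (K * K) * value m - + 4 * b * K * lin (level m) (route m) - b * b
        where K = + 2 * + scale (level m)
              b = + a (suc m)

      -- The minimal energy when v is the state after the block.
      least : ℕ → ℤ → ℤ
      least m v = value m - + 2 * v * route m (pred-length (level m)) - v * v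

      -- The translation of the left copy by `b` contributes `K * b * ∑ρ`, which the coefficient
      -- `1 - K * ∑ρ` of the new vertex replaces by `b`, the next digit.
      pos-route : ∀ m → pos (level m) (route m) ≡ param m
      pos-route zero = trans (∑-first 0 (λ _ → 1ℤ * + a 0)) (trans (cong (_+_ (1ℤ * + a 0)) (∑-empty (λ _ → 1ℤ * + a 0))) (lemma (+ a 0)))
        where
        lemma : ∀ x → 1ℤ * x + 0ℤ ≡ x
        lemma = solve-∀
      pos-route (suc m) = begin
        pos (level (suc m)) π
          ≡⟨ Double.pos-double (+ scale B) B π ⟩
        K * pos B π + (1ℤ - K * ∑ρ B) * π L
          ≡⟨ cong₂ (λ x y → K * x + (1ℤ - K * ∑ρ B) * y)
               (trans (∑-shift L (ρ B) b (route m) π λ i i<L → glue-left L _ _ _ i i<L)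
                      (cong (_+_ (b * ∑ρ B)) (pos-route m)))
               (glue-mid L _ _ _) ⟩
        K * (b * ∑ρ B + param m) + (1ℤ - K * ∑ρ B) * b
          ≡⟨ lemma K b (∑ρ B) (param m) ⟩
        K * param m + b ∎
        where
        open ≡-Reasoning
        B = level m
        L = size B
        K = + 2 * + scale B
        b = + a (suc m)
        π = route (suc m)
        lemma : ∀ K b s p → K * (b * s + p) + (1ℤ - K * s) * b ≡ K * p + b
        lemma = solve-∀

      -- Completing the square in `y 0`.
      energy-unit : ∀ y → energy unit (+ a 0) y ≡
        least 0 (y 1) + (y 0 - (y 1 + + a 0)) * (y 0 - (y 1 + + a 0))
      energy-unit y = trans
        (cong₂ (λ s t → s - + 2 * + a 0 * t)
          (cong₂ _+_ (single (λ i → 1ℤ * (y i * y i))) (single (λ i → - (+ 2) * (y i * y (suc i)))))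
          (single (λ i → 1ℤ * y i)))
        (lemma (y 0) (y 1) (+ a 0))
        where
        single : ∀ f → ∑< 1 f ≡ f 0 + 0ℤ
        single f = trans (∑-first 0 f) (cong (_+_ (f 0)) (∑-empty (f ∘ suc)))
        lemma : ∀ x v a → 1ℤ * (x * x) + 0ℤ + (- (+ 2) * (x * v) + 0ℤ) - + 2 * a * (1ℤ * x + 0ℤ)
          ≡ - (a * a) - + 2 * v * a - v * v + (x - (v + a)) * (x - (v + a))
        lemma = solve-∀

      module Step (m : ℕ) (y : ℕ → ℤ) where

        B = level m
        L = size B
        κ = + scale B
        K = + 2 * κ
        b = + a (suc m)
        r = Double.flip κ B y
        u = y L
        v = y (size (level (suc m)))
        π = route m
        π₀ = route m 0

        follows-mid : Follows (level (suc m)) (route (suc m)) y → u ≡ v + b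
        follows-mid f = trans (f L (s≤s (ℕ.m≤m+n L L))) (cong (_+_ v) (glue-mid L _ _ _))

        follows-left : Follows (level (suc m)) (route (suc m)) y → Follows B π y
        follows-left f i i<L = trans (f i (ℕ.<-≤-trans i<L (ℕ.m≤n⇒m≤1+n (ℕ.m≤m+n L L))))
          (trans (cong (_+_ v) (glue-left L _ _ _ i i<L))
          (trans (sym (ℤ.+-assoc v b (π i))) (cong (_+ π i) (sym (follows-mid f)))))
        r-end : r L ≡ - u
        r-end = cong (λ k → - y k) (ℕ.m+n∸n≡m L L)

        follows-right : Follows (level (suc m)) (route (suc m)) y → Follows B π r
        follows-right f i i<L = begin
          - y (L ℕ.+ L ∸ i)  ≡⟨ cong -_ (f (L ℕ.+ L ∸ i) (s≤s (ℕ.m∸n≤m (L ℕ.+ L) i))) ⟩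
          - (v + route (suc m) (L ℕ.+ L ∸ i))
            ≡⟨ cong (λ z → - (v + z)) (glue-right L _ _ _ i i<L) ⟩
          - (v + (b - π i))  ≡⟨ lemma v b (π i) ⟩
          - (v + b) + π i    ≡⟨ cong (λ z → - z + π i) (follows-mid f) ⟨
          - u + π i          ≡⟨ cong (_+ π i) r-end ⟨
          r L + π i          ∎
          where
          open ≡-Reasoning
          lemma : ∀ v b x → - (v + (b - x)) ≡ - (v + b) + x
          lemma = solve-∀

        follows-join : u ≡ v + b → Follows B π y → Follows B π r → Follows (level (suc m)) (route (suc m)) y
        follows-join u≡v+b fy fr = glue-elim L _ _ _ (λ i z → y i ≡ v + z)
          (λ i i<L → trans (fy i i<L) (trans (cong (_+ π i) u≡v+b) (ℤ.+-assoc v b (π i))))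
          u≡v+b
          (λ i i<L → begin
            y (L ℕ.+ L ∸ i)    ≡⟨ ℤ.neg-involutive _ ⟨
            - r i              ≡⟨ cong -_ (fr i i<L) ⟩
            - (r L + π i)      ≡⟨ cong (λ z → - (z + π i)) (trans r-end (cong -_ u≡v+b)) ⟩
            - (- (v + b) + π i) ≡⟨ lemma v b (π i) ⟩
            v + (b - π i)      ∎)
          where
          open ≡-Reasoning
          lemma : ∀ v b x → - (- (v + b) + x) ≡ v + (b - x)
          lemma = solve-∀

        -- The right copy is followed by `- u`, so the terms linear in `u` cancel. Hence at scale
        -- `K * K` every `u` is equally good.
        least-cancel : least m u + least m (r L) + + 2 * (u * u) - + 2 * value m ≡ 0ℤ
        least-cancel = trans (cong (λ z → least m u + least m z + + 2 * (u * u) - + 2 * value m) r-end)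
                             (lemma (value m) u (π (pred-length B)))
          where
          lemma : ∀ c u z → c - + 2 * u * z - u * u + (c - + 2 * - u * z - - u * - u)
                    + + 2 * (u * u) - + 2 * c ≡ 0ℤ
          lemma = solve-∀

        -- What the terms below scale K² can gain over the optimal route.
        δ : ℤ
        δ = κ * (- (+ 8) * b * lin B π + + 4 * b * (lin B y + lin B r) - (sq B y - sq B r) + + 4 * param m * u)
            + (- (b * b) - + 2 * v * (b - π₀) - v * v - u * u + + 2 * b * u - + 2 * r 0 * v)

        least-suc : least (suc m) v ≡
          + 2 * (K * K) * value m - + 4 * b * K * lin B π - b * b - + 2 * v * (b - π₀) - v * v
        least-suc = cong (λ z → value (suc m) - + 2 * v * z - v * v)
                         (glue-right L _ _ _ 0 (s≤s z≤n))

        -- An identity for arbitrary `y`: as the parameter is `K * param m + b`, its product with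
        -- the terms of scale `K` in `lin` completes `K * K * quad` to the energies of both copies
        -- at `param m`. All that is left over is collected in `δ`.
        energy-step : energy (level (suc m)) (param (suc m)) y ≡
          least (suc m) v - δ + K * K *
            (energy B (param m) y + energy B (param m) r + + 2 * (u * u) - + 2 * value m)
        energy-step = trans
          (cong₂ (λ s t → s - + 2 * param (suc m) * t)
            (Double.quad-double κ B y) (Double.lin-double κ B y))
          (trans
            (lemma κ b u v (r 0) π₀ (param m) (value m) (lin B π)
              (lin B y) (lin B r) (quad B y) (quad B r) (sq B y) (sq B r))
            (cong (λ z → z - δ + K * K * (energy B (param m) y + energy B (param m) r
                            + + 2 * (u * u) - + 2 * value m)) (sym least-suc)))
          where
          lemma : ∀ k b u v r p l c w ly lr qy qr sy sr →
            + 2 * k * (+ 2 * k) * (qy + qr + + 2 * (u * u)) + k * (sy - sr) + u * u + + 2 * r * v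
              - + 2 * (+ 2 * k * l + b) * (+ 2 * k * (ly + lr) + u)
            ≡ + 2 * (+ 2 * k * (+ 2 * k)) * c - + 4 * b * (+ 2 * k) * w - b * b - + 2 * v * (b - p) - v * v
              - (k * (- (+ 8) * b * w + + 4 * b * (ly + lr) - (sy - sr) + + 4 * l * u)
                 + (- (b * b) - + 2 * v * (b - p) - v * v - u * u + + 2 * b * u - + 2 * r * v))
              + + 2 * k * (+ 2 * k) * (qy - + 2 * l * ly + (qr - + 2 * l * lr) + + 2 * (u * u) - + 2 * c)
          lemma = solve-∀

        -- On the routes, `lin B y + lin B r` no longer depends on `u`, and the difference of the
        -- `sq` terms is `4 * param m * u` by `pos-route`. So the coefficient of `κ` vanishes and
        -- only a square centred at `v + b` survives.
        δ-follows : Follows B π y → Follows B π r → δ ≡ - ((u - (v + b)) * (u - (v + b)))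
        δ-follows fy fr = trans
          (cong₂ (λ s t → κ * s + t)
            (cong₂ (λ s t → - (+ 8) * b * lin B π + + 4 * b * s - t + + 4 * param m * u)
               (cong₂ _+_ (∑-shift L (σ B) u π y fy) (∑-shift L (σ B) (- u) π r fr′))
               (cong₂ _-_ (∑-shift² L (ρ B) u π y fy) (∑-shift² L (ρ B) (- u) π r fr′)))
            (cong (λ z → - (b * b) - + 2 * v * (b - π₀) - v * v - u * u + + 2 * b * u - + 2 * z * v)
                  (fr′ 0 (s≤s z≤n))))
          (trans (cong (λ z → κ * (- (+ 8) * b * lin B π
                          + + 4 * b * (u * ∑< L (σ B) + lin B π + (- u * ∑< L (σ B) + lin B π))
                          - (u * u * ∑ρ B + + 2 * u * z + sq B π
                             - (- u * - u * ∑ρ B + + 2 * - u * z + sq B π)) + + 4 * param m * u)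
                         + (- (b * b) - + 2 * v * (b - π₀) - v * v - u * u + + 2 * b * u
                            - + 2 * (- u + π₀) * v))
                       (pos-route m))
                 (lemma κ b u v π₀ (param m) (∑< L (σ B)) (∑ρ B) (lin B π) (sq B π)))
          where
          fr′ : ∀ i → i ℕ.< L → r i ≡ - u + π i
          fr′ i i<L = trans (fr i i<L) (cong (_+ π i) r-end)
          lemma : ∀ k b u v p l s t w q →
            k * (- (+ 8) * b * w + + 4 * b * (u * s + w + (- u * s + w))
                 - (u * u * t + + 2 * u * l + q - (- u * - u * t + + 2 * - u * l + q)) + + 4 * l * u)
            + (- (b * b) - + 2 * v * (b - p) - v * v - u * u + + 2 * b * u - + 2 * (- u + p) * v)
            ≡ - ((u - (v + b)) * (u - (v + b)))
          lemma = solve-∀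

        module _ (b≤R : a (suc m) ℕ.≤ R) (y≤R : ∀ i → ∣ y i ∣ ℕ.≤ R) (π≤R : ∀ i → ∣ π i ∣ ℕ.≤ R) where

          r≤R : ∀ i → ∣ r i ∣ ℕ.≤ R
          r≤R i = ∣neg∣≤ {y (L ℕ.+ L ∸ i)} (y≤R (L ℕ.+ L ∸ i))

          lin≤ : ∀ z → (∀ i → ∣ z i ∣ ℕ.≤ R) → ∣ lin B z ∣ ℕ.≤ ∥σ∥ B ℕ.* R
          lin≤ z = ∑-bounded L (σ B) z R

          sq≤ : ∀ z → (∀ i → ∣ z i ∣ ℕ.≤ R) → ∣ sq B z ∣ ℕ.≤ ∥ρ∥ B ℕ.* (R ℕ.* R)
          sq≤ z z≤R = ∑-bounded L (ρ B) (λ i → z i * z i) (R ℕ.* R) (λ i → ∣*∣≤ {z i} {z i} (z≤R i) (z≤R i))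

          param≤ : ∣ param m ∣ ℕ.≤ ∥ρ∥ B ℕ.* R
          param≤ = subst (λ z → ∣ z ∣ ℕ.≤ ∥ρ∥ B ℕ.* R) (pos-route m) (∑-bounded L (ρ B) π R π≤R)

          δ-coarse δ-fine : ℤ
          δ-coarse = - (+ 8) * b * lin B π + + 4 * b * (lin B y + lin B r) - (sq B y - sq B r) + + 4 * param m * u
          δ-fine   = - (b * b) - + 2 * v * (b - π₀) - v * v - u * u + + 2 * b * u - + 2 * r 0 * v

          δ-coarse≤ : ∣ δ-coarse ∣ ℕ.≤ (16 ℕ.* ∥σ∥ B ℕ.+ 6 ℕ.* ∥ρ∥ B) ℕ.* (R ℕ.* R)
          δ-coarse≤ = ℕ.≤-trans
            (∣+∣≤ { - (+ 8) * b * lin B π + + 4 * b * (lin B y + lin B r) - (sq B y - sq B r)} {+ 4 * param m * u}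
              (∣-∣≤ { - (+ 8) * b * lin B π + + 4 * b * (lin B y + lin B r)} {sq B y - sq B r}
                (∣+∣≤ { - (+ 8) * b * lin B π} {+ 4 * b * (lin B y + lin B r)}
                  (∣*∣≤ { - (+ 8) * b} {lin B π} (∣*∣≤ { - (+ 8)} {b} {8} ℕ.≤-refl b≤R) (lin≤ π π≤R))
                  (∣*∣≤ {+ 4 * b} {lin B y + lin B r} (∣*∣≤ {+ 4} {b} {4} ℕ.≤-refl b≤R)
                    (∣+∣≤ {lin B y} {lin B r} (lin≤ y y≤R) (lin≤ r r≤R))))
                (∣-∣≤ {sq B y} {sq B r} (sq≤ y y≤R) (sq≤ r r≤R)))
              (∣*∣≤ {+ 4 * param m} {u} (∣*∣≤ {+ 4} {param m} {4} ℕ.≤-refl param≤) (y≤R L)))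
            (ℕ.≤-reflexive (lemma R (∥σ∥ B) (∥ρ∥ B)))
            where
            lemma : ∀ R S P → 8 ℕ.* R ℕ.* (S ℕ.* R) ℕ.+ 4 ℕ.* R ℕ.* (S ℕ.* R ℕ.+ S ℕ.* R)
              ℕ.+ (P ℕ.* (R ℕ.* R) ℕ.+ P ℕ.* (R ℕ.* R)) ℕ.+ 4 ℕ.* (P ℕ.* R) ℕ.* R
              ≡ (16 ℕ.* S ℕ.+ 6 ℕ.* P) ℕ.* (R ℕ.* R)
            lemma = ℕ-Solver.solve-∀

          δ-fine≤ : ∣ δ-fine ∣ ℕ.≤ 11 ℕ.* (R ℕ.* R)
          δ-fine≤ = ℕ.≤-trans
            (∣-∣≤ { - (b * b) - + 2 * v * (b - π₀) - v * v - u * u + + 2 * b * u} {+ 2 * r 0 * v}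
              (∣+∣≤ { - (b * b) - + 2 * v * (b - π₀) - v * v - u * u} {+ 2 * b * u}
                (∣-∣≤ { - (b * b) - + 2 * v * (b - π₀) - v * v} {u * u}
                  (∣-∣≤ { - (b * b) - + 2 * v * (b - π₀)} {v * v}
                    (∣-∣≤ { - (b * b)} {+ 2 * v * (b - π₀)}
                      (∣neg∣≤ {b * b} (∣*∣≤ {b} {b} b≤R b≤R))
                      (∣*∣≤ {+ 2 * v} {b - π₀} (∣*∣≤ {+ 2} {v} {2} ℕ.≤-refl v≤R)
                        (∣-∣≤ {b} {π₀} b≤R (π≤R 0))))
                    (∣*∣≤ {v} {v} v≤R v≤R))
                  (∣*∣≤ {u} {u} (y≤R L) (y≤R L)))
                (∣*∣≤ {+ 2 * b} {u} (∣*∣≤ {+ 2} {b} {2} ℕ.≤-refl b≤R) (y≤R L)))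
              (∣*∣≤ {+ 2 * r 0} {v} (∣*∣≤ {+ 2} {r 0} {2} ℕ.≤-refl (r≤R 0)) v≤R))
            (ℕ.≤-reflexive (lemma R))
            where
            v≤R = y≤R (size (level (suc m)))
            lemma : ∀ R → R ℕ.* R ℕ.+ 2 ℕ.* R ℕ.* (R ℕ.+ R) ℕ.+ R ℕ.* R ℕ.+ R ℕ.* R
              ℕ.+ 2 ℕ.* R ℕ.* R ℕ.+ 2 ℕ.* R ℕ.* R ≡ 11 ℕ.* (R ℕ.* R)
            lemma = ℕ-Solver.solve-∀

          1+∣δ∣≤K² : suc ∣ δ ∣ ℕ.≤ 4 ℕ.* (scale B ℕ.* scale B)
          1+∣δ∣≤K² = begin
            suc ∣ κ * δ-coarse + δ-fine ∣
              ≤⟨ s≤s (∣+∣≤ {κ * δ-coarse} {δ-fine} (∣*∣≤ {κ} {δ-coarse} ℕ.≤-refl δ-coarse≤) δ-fine≤) ⟩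
            suc (scale B ℕ.* ((16 ℕ.* S ℕ.+ 6 ℕ.* P) ℕ.* R²) ℕ.+ 11 ℕ.* R²)
              ≤⟨ ℕ.m≤m+n _ (rest (4 ℕ.* S ℕ.+ 2 ℕ.* P) (P ℕ.* R²) R²) ⟩
            suc (scale B ℕ.* ((16 ℕ.* S ℕ.+ 6 ℕ.* P) ℕ.* R²) ℕ.+ 11 ℕ.* R²)
              ℕ.+ rest (4 ℕ.* S ℕ.+ 2 ℕ.* P) (P ℕ.* R²) R²
              ≡⟨ lemma S P R² ⟩
            4 ℕ.* (scale B ℕ.* scale B) ∎
            where
            open ℕ.≤-Reasoning
            S = ∥σ∥ B
            P = ∥ρ∥ B
            R² = R ℕ.* R
            -- The exact slack of the inequality, written out so that the estimate becomes a
            -- polynomial identity.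
            rest : ℕ → ℕ → ℕ → ℕ
            rest Q T X = ((Q ℕ.+ 11) ℕ.* X ℕ.+ 1) ℕ.* (2 ℕ.* T ℕ.+ 44 ℕ.* X) ℕ.+ 3 ℕ.+ (4 ℕ.* Q ℕ.+ 33) ℕ.* X
            lemma : ∀ S P X →
              let s = (4 ℕ.* S ℕ.+ 2 ℕ.* P ℕ.+ 11) ℕ.* X ℕ.+ 1
                  Q = 4 ℕ.* S ℕ.+ 2 ℕ.* P
              in suc (s ℕ.* ((16 ℕ.* S ℕ.+ 6 ℕ.* P) ℕ.* X) ℕ.+ 11 ℕ.* X)
                   ℕ.+ (((Q ℕ.+ 11) ℕ.* X ℕ.+ 1) ℕ.* (2 ℕ.* (P ℕ.* X) ℕ.+ 44 ℕ.* X) ℕ.+ 3 ℕ.+ (4 ℕ.* Q ℕ.+ 33) ℕ.* X)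
                 ≡ 4 ℕ.* (s ℕ.* s)
            lemma = ℕ-Solver.solve-∀

      -- By `energy-step`: the factor of `K * K` is zero by induction and `least-cancel`, and the
      -- square in `δ-follows` is zero because `u` is `v + b`.
      energy-follows : ∀ m y → Follows (level m) (route m) y →
        energy (level m) (param m) y ≡ least m (y (size (level m)))
      energy-follows zero y f = trans (energy-unit y)
        (trans (cong (λ z → least 0 (y 1) + (z - (y 1 + + a 0)) * (z - (y 1 + + a 0))) (f 0 (s≤s z≤n)))
               (lemma (least 0 (y 1)) (y 1 + + a 0)))
        where
        lemma : ∀ e x → e + (x - x) * (x - x) ≡ e
        lemma = solve-∀
      energy-follows (suc m) y f = begin
        energy (level (suc m)) (param (suc m)) y
          ≡⟨ energy-step ⟩
        least (suc m) v - δ + K * K * (energy B (param m) y + energy B (param m) r + + 2 * (u * u) - + 2 * value m)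
          ≡⟨ cong₂ (λ s t → least (suc m) v - s + K * K * t)
               (trans (δ-follows (follows-left f) (follows-right f))
                      (cong (λ z → - ((z - (v + b)) * (z - (v + b)))) (follows-mid f)))
               (trans (cong₂ (λ s t → s + t + + 2 * (u * u) - + 2 * value m)
                        (energy-follows m y (follows-left f)) (energy-follows m r (follows-right f)))
                      least-cancel) ⟩
        least (suc m) v - - ((v + b - (v + b)) * (v + b - (v + b))) + K * K * 0ℤ
          ≡⟨ lemma (least (suc m) v) (v + b) K ⟩
        least (suc m) v ∎
        where
        open ≡-Reasoning
        open Step m y
        lemma : ∀ e x K → e - - ((x - x) * (x - x)) + K * K * 0ℤ ≡ e
        lemma = solve-∀

      module _ (A : ℕ) (a≤A : ∀ k → a k ℕ.≤ A) where

        -- One more digit per level, so the number of states needed grows linearly in `m` although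
        -- the number of layers doubles.
        route-bounded : ∀ m i → ∣ route m i ∣ ℕ.≤ suc m ℕ.* A
        route-bounded zero    i = ℕ.≤-trans (a≤A 0) (ℕ.≤-reflexive (sym (ℕ.+-identityʳ A)))
        route-bounded (suc m) = glue-all (size (level m)) _ _ _ (λ z → ∣ z ∣ ℕ.≤ suc (suc m) ℕ.* A)
          (λ i → ∣+∣≤ {+ a (suc m)} {route m i} (a≤A (suc m)) (route-bounded m i))
          (ℕ.≤-trans (a≤A (suc m)) (ℕ.m≤m+n A _))
          (λ i → ∣-∣≤ {+ a (suc m)} {route m i} (a≤A (suc m)) (route-bounded m i))

        -- Unique optimality with an integer gap of 1, the form in which it can be amplified by
        -- `K * K` in the induction.
        Dichotomy : ℕ → (ℕ → ℤ) → Set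
        Dichotomy m y = Follows (level m) (route m) y
          ⊎ 1ℤ + least m (y (size (level m))) ≤ energy (level m) (param m) y

        dichotomy-least : ∀ m y → Dichotomy m y → least m (y (size (level m))) ≤ energy (level m) (param m) y
        dichotomy-least m y (inj₁ f) = ℤ.≤-reflexive (sym (energy-follows m y f))
        dichotomy-least m y (inj₂ l) = ℤ.≤-trans (ℤ.i≤j+i _ 1ℤ) l

        -- If a copy leaves its route, `K * K` times its gap outweighs `δ`. If neither does, the
        -- energy exceeds the least one by exactly the square of `u - (v + b)`, which is 0 or at
        -- least 1.
        dichotomy : ∀ m → suc m ℕ.* A ℕ.≤ R → ∀ y → (∀ i → ∣ y i ∣ ℕ.≤ R) → Dichotomy m y
        dichotomy zero _ y y≤R with y 0 ℤ.≟ y 1 + + a 0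
        ... | yes y₀≡ = inj₁ λ { zero _ → y₀≡ ; (suc _) (s≤s ()) }
        ... | no  y₀≢ = inj₂ (begin
          1ℤ + least 0 (y 1)
            ≡⟨ ℤ.+-comm 1ℤ (least 0 (y 1)) ⟩
          least 0 (y 1) + 1ℤ
            ≤⟨ ℤ.+-monoʳ-≤ (least 0 (y 1)) (1≤i*i _ (λ e → y₀≢ (ℤ.i-j≡0⇒i≡j (y 0) _ e))) ⟩
          least 0 (y 1) + (y 0 - (y 1 + + a 0)) * (y 0 - (y 1 + + a 0))
            ≡⟨ energy-unit y ⟨
          energy unit (+ a 0) y ∎)
          where open ℤ.≤-Reasoning
        dichotomy (suc m) A≤R y y≤R = result (dichotomy m A≤R′ y y≤R) (dichotomy m A≤R′ r r≤)
          where
          open Step m y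
          A≤R′ = ℕ.≤-trans (ℕ.m≤n+m (suc m ℕ.* A) A) A≤R
          b≤R = ℕ.≤-trans (a≤A (suc m)) (ℕ.≤-trans (ℕ.m≤m+n A _) A≤R)
          π≤R = λ i → ℕ.≤-trans (route-bounded m i) A≤R′
          r≤ = r≤R b≤R y≤R π≤R
          excess : ℤ
          excess = energy B (param m) y + energy B (param m) r + + 2 * (u * u) - + 2 * value m
          off-route : 1ℤ ≤ excess → 1ℤ + least (suc m) v ≤ energy (level (suc m)) (param (suc m)) y
          off-route 1≤excess = begin
            1ℤ + least (suc m) v
              ≡⟨ lemma₁ δ (least (suc m) v) ⟩
            least (suc m) v - δ + (1ℤ + δ)
              ≤⟨ ℤ.+-monoʳ-≤ (least (suc m) v - δ) (begin
                1ℤ + δ          ≤⟨ ℤ.+-monoʳ-≤ 1ℤ (i≤+∣i∣ δ) ⟩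
                + suc ∣ δ ∣     ≤⟨ ℤ.+≤+ (1+∣δ∣≤K² b≤R y≤R π≤R) ⟩
                + K²            ≡⟨ ℤ.*-identityʳ (+ K²) ⟨
                + K² * 1ℤ       ≤⟨ ℤ.*-monoˡ-≤-nonNeg (+ K²) 1≤excess ⟩
                + K² * excess   ≡⟨ cong (_* excess) K²≡ ⟩
                K * K * excess  ∎) ⟩
            least (suc m) v - δ + K * K * excess
              ≡⟨ energy-step ⟨
            energy (level (suc m)) (param (suc m)) y ∎
            where
            open ℤ.≤-Reasoning
            K² = 4 ℕ.* (scale B ℕ.* scale B)
            K²≡ : + K² ≡ K * K
            K²≡ = trans (ℤ.pos-* 4 (scale B ℕ.* scale B)) (trans (cong (_*_ (+ 4)) (ℤ.pos-* (scale B) (scale B))) (lemma κ))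
              where
              lemma : ∀ k → + 4 * (k * k) ≡ + 2 * k * (+ 2 * k)
              lemma = solve-∀
            lemma₁ : ∀ d l → 1ℤ + l ≡ l - d + (1ℤ + d)
            lemma₁ = solve-∀
          excess≥ : ∀ {s t} → s + least m u ≤ energy B (param m) y → t + least m (r L) ≤ energy B (param m) r →
            s + t ≡ 1ℤ → 1ℤ ≤ excess
          excess≥ {s} {t} p q s+t≡1 = begin
            1ℤ
              ≡⟨ trans (sym (ℤ.+-identityʳ 1ℤ)) (cong₂ _+_ (sym s+t≡1) (sym least-cancel)) ⟩
            s + t + (least m u + least m (r L) + + 2 * (u * u) - + 2 * value m)
              ≡⟨ lemma s t (least m u) (least m (r L)) (+ 2 * (u * u)) (+ 2 * value m) ⟩
            s + least m u + (t + least m (r L)) + + 2 * (u * u) - + 2 * value m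
              ≤⟨ ℤ.+-monoˡ-≤ (- (+ 2 * value m)) (ℤ.+-monoˡ-≤ (+ 2 * (u * u)) (ℤ.+-mono-≤ p q)) ⟩
            excess ∎
            where
            open ℤ.≤-Reasoning
            lemma : ∀ s t x z w c → s + t + (x + z + w - c) ≡ s + x + (t + z) + w - c
            lemma = solve-∀
          weaken : ∀ z → Dichotomy m z → 0ℤ + least m (z L) ≤ energy B (param m) z
          weaken z d = ℤ.≤-trans (ℤ.≤-reflexive (ℤ.+-identityˡ _)) (dichotomy-least m z d)
          result : Dichotomy m y → Dichotomy m r → Dichotomy (suc m) y
          result (inj₂ p) d        = inj₂ (off-route (excess≥ {1ℤ} {0ℤ} p (weaken r d) refl))
          result (inj₁ f) (inj₂ q) = inj₂ (off-route (excess≥ {0ℤ} {1ℤ} (weaken y (inj₁ f)) q refl))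
          result (inj₁ f) (inj₁ g) with u ℤ.≟ v + b
          ... | yes u≡ = inj₁ (follows-join u≡ f g)
          ... | no  u≢ = inj₂ (begin
            1ℤ + least (suc m) v
              ≤⟨ ℤ.+-monoˡ-≤ (least (suc m) v) (1≤i*i _ (λ e → u≢ (ℤ.i-j≡0⇒i≡j u _ e))) ⟩
            (u - (v + b)) * (u - (v + b)) + least (suc m) v
              ≡⟨ lemma (u - (v + b)) (least (suc m) v) K ⟩
            least (suc m) v - - ((u - (v + b)) * (u - (v + b))) + K * K * 0ℤ
              ≡⟨ cong₂ (λ s t → least (suc m) v - s + K * K * t) (sym (δ-follows f g))
                   (sym (trans (cong₂ (λ s t → s + t + + 2 * (u * u) - + 2 * value m)
                                  (energy-follows m y f) (energy-follows m r g))
                               least-cancel)) ⟩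
            least (suc m) v - δ + K * K * excess
              ≡⟨ energy-step ⟨
            energy (level (suc m)) (param (suc m)) y ∎)
            where
            open ℤ.≤-Reasoning
            lemma : ∀ x l K → x * x + l ≡ l - - (x * x) + K * K * 0ℤ
            lemma = solve-∀

    -- The middle entry is the last digit; subtracting it from the left half gives the route one
    -- level below.
    route-injective : ∀ a a′ m → (∀ i → i ℕ.< size (level m) → route a m i ≡ route a′ m i) →
      ∀ k → k ℕ.≤ m → a k ≡ a′ k
    route-injective a a′ zero    eq zero z≤n = ℤ.+-injective (eq 0 (s≤s z≤n))
    route-injective a a′ (suc m) eq = λ k k≤ → cases k (ℕ.m≤n⇒m<n∨m≡n k≤)
      where
      L = size (level m)
      top : a (suc m) ≡ a′ (suc m)
      top = ℤ.+-injective (trans (sym (glue-mid L _ _ _)) (trans (eq L (s≤s (ℕ.m≤m+n L L))) (glue-mid L _ _ _)))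
      lower : ∀ i → i ℕ.< L → route a m i ≡ route a′ m i
      lower i i<L = ∙-cancelˡ (+ a (suc m)) _ _
        (trans (trans (sym (glue-left L _ _ _ i i<L))
               (trans (eq i (ℕ.<-≤-trans i<L (ℕ.m≤n⇒m≤1+n (ℕ.m≤m+n L L)))) (glue-left L _ _ _ i i<L)))
               (cong (λ z → + z + route a′ m i) (sym top)))
      cases : ∀ k → k ℕ.< suc m ⊎ k ≡ suc m → a k ≡ a′ k
      cases k (inj₁ k≤m)  = route-injective a a′ m lower k (ℕ.≤-pred k≤m)
      cases k (inj₂ refl) = top

-- The order of the reals, and covers of layered graphs by shortest paths.

module Covers where

  open import Data.List.Base using (List; []; _∷_; lookup; map; concatMap; allFin; deduplicate)
  import Data.List.Membership.DecPropositional as DecMembership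
  open import Data.List.Membership.Propositional using (_∈_)
  open import Data.List.Membership.Propositional.Properties
    using (∈-map⁺; ∈-concatMap⁺; ∈-allFin; ∈-deduplicate⁺)
  open import Data.List.Relation.Unary.All as All using (All; []; _∷_)
  open import Data.List.Relation.Unary.AllPairs using ([]; _∷_)
  open import Data.List.Relation.Unary.Any as Any using (here; there)
  open import Data.List.Relation.Unary.Any.Properties using (lookup-index)
  open import Data.List.Relation.Unary.Unique.DecPropositional.Properties using (deduplicate-!)
  open import Data.Nat.Induction using (<-rec)
  open import Data.Rational.Base using (0ℚ; ½; -_; _+_; _-_; _*_; _≤_; _<_; ∣_∣)
  import Data.Rational.Properties as ℚ
  open import Data.Rational.Solver using (module +-*-Solver)
  open import Relation.Binary.Construct.Closure.ReflexiveTransitive using (ε; _◅_)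
  open import Relation.Binary.Construct.Closure.Transitive using (TransClosure; [_]; _∷_)
  open import Relation.Binary.Definitions using (DecidableEquality)
  open import Relation.Nullary.Decidable using (decidable-stable)

  -- The order of the reals

  ½*-positive : ∀ {δ} → 0ℚ < δ → 0ℚ < ½ * δ
  ½*-positive {δ} 0<δ = subst (_< ½ * δ) (ℚ.*-zeroʳ ½) (ℚ.*-monoʳ-<-pos ½ 0<δ)

  ½*+½* : ∀ δ → ½ * δ + ½ * δ ≡ δ
  ½*+½* δ = trans (sym (ℚ.*-distribʳ-+ δ ½ ½)) (ℚ.*-identityˡ δ)

  p≤∣p∣ : ∀ p → p ≤ ∣ p ∣
  p≤∣p∣ p with ℚ.≤-total 0ℚ p
  ... | inj₁ 0≤p = ℚ.≤-reflexive (sym (ℚ.0≤p⇒∣p∣≡p 0≤p))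
  ... | inj₂ p≤0 = ℚ.≤-trans p≤0 (ℚ.0≤∣p∣ p)

  ∣p-q∣<δ⇒p≤q+δ : ∀ p q {δ} → ∣ p - q ∣ < δ → p ≤ q + δ
  ∣p-q∣<δ⇒p≤q+δ p q {δ} h = begin
    p            ≡⟨ split p q ⟩
    q + (p - q)  ≤⟨ ℚ.+-monoʳ-≤ q (ℚ.≤-trans (p≤∣p∣ (p - q)) (ℚ.<⇒≤ h)) ⟩
    q + δ        ∎
    where
    open ℚ.≤-Reasoning
    open +-*-Solver
    split : ∀ a b → a ≡ b + (a - b)
    split = solve 2 (λ a b → a := b :+ (a :+ (:- b))) refl

  ≤ᴿ-refl : ∀ x → x ≤ᴿ x
  ≤ᴿ-refl x δ 0<δ = 0 , λ n _ → ℚ.≤-trans (ℚ.≤-reflexive (sym (ℚ.+-identityʳ _))) (ℚ.+-monoʳ-≤ (seq x n) (ℚ.<⇒≤ 0<δ))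

  ≤ᴿ-trans : ∀ {x y z} → x ≤ᴿ y → y ≤ᴿ z → x ≤ᴿ z
  ≤ᴿ-trans {x} {y} {z} x≤y y≤z δ 0<δ with x≤y (½ * δ) (½*-positive 0<δ) | y≤z (½ * δ) (½*-positive 0<δ)
  ... | M , p | N , q = M ℕ.⊔ N , λ n M⊔N≤n → begin
    seq x n                    ≤⟨ p n (ℕ.m⊔n≤o⇒m≤o M N M⊔N≤n) ⟩
    seq y n + ½ * δ            ≤⟨ ℚ.+-monoˡ-≤ (½ * δ) (q n (ℕ.m⊔n≤o⇒n≤o M N M⊔N≤n)) ⟩
    seq z n + ½ * δ + ½ * δ    ≡⟨ ℚ.+-assoc (seq z n) _ _ ⟩
    seq z n + (½ * δ + ½ * δ)  ≡⟨ cong (seq z n +_) (½*+½* δ) ⟩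
    seq z n + δ                ∎
    where open ℚ.≤-Reasoning

  -- If x exceeds y by δ / 2 at one late index then y ≤ x, and otherwise δ is no
  -- obstacle to x ≤ y.
  ≤ᴿ-weakly-total : ∀ x y → ¬ ¬ (x ≤ᴿ y ⊎ y ≤ᴿ x)
  ≤ᴿ-weakly-total x y ¬total = ¬total (inj₁ x≤y)
    where
    open ℚ.≤-Reasoning
    x≤y : x ≤ᴿ y
    x≤y δ 0<δ with cauchy x (½ * (½ * δ)) (½*-positive (½*-positive 0<δ))
                 | cauchy y (½ * (½ * δ)) (½*-positive (½*-positive 0<δ))
    ... | M , p | N , q = N′ , compare (ℚ.≤-total (seq x N′) (seq y N′ + ½ * δ))
      where
      N′ = M ℕ.⊔ N
      ε′ = ½ * (½ * δ)
      M≤ = ℕ.m≤m⊔n M N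
      N≤ = ℕ.m≤n⊔m M N
      compare : seq x N′ ≤ seq y N′ + ½ * δ ⊎ seq y N′ + ½ * δ ≤ seq x N′ →
        ∀ n → N′ ℕ.≤ n → seq x n ≤ seq y n + δ
      compare (inj₁ h) n N′≤n = begin
        seq x n                      ≤⟨ ∣p-q∣<δ⇒p≤q+δ (seq x n) (seq x N′) (p n N′ (ℕ.≤-trans M≤ N′≤n) M≤) ⟩
        seq x N′ + ε′                ≤⟨ ℚ.+-monoˡ-≤ ε′ h ⟩
        seq y N′ + ½ * δ + ε′
          ≤⟨ ℚ.+-monoˡ-≤ ε′ (ℚ.+-monoˡ-≤ (½ * δ) (∣p-q∣<δ⇒p≤q+δ (seq y N′) (seq y n) (q N′ n N≤ (ℕ.≤-trans N≤ N′≤n)))) ⟩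
        seq y n + ε′ + ½ * δ + ε′    ≡⟨ rearrange (seq y n) ε′ (½ * δ) ⟩
        seq y n + (ε′ + ε′ + ½ * δ)
          ≡⟨ cong (seq y n +_) (trans (cong (_+ ½ * δ) (½*+½* (½ * δ))) (½*+½* δ)) ⟩
        seq y n + δ                  ∎
        where
        open +-*-Solver
        rearrange : ∀ a b c → a + b + c + b ≡ a + (b + b + c)
        rearrange = solve 3 (λ a b c → a :+ b :+ c :+ b := a :+ (b :+ b :+ c)) refl
      compare (inj₂ h) _ _ = contradiction (inj₂ y≤x) ¬total
        where
        rearrange : ∀ a b → a + (b + b) ≡ a + b + b
        rearrange a b = sym (ℚ.+-assoc a b b)
        y≤x : y ≤ᴿ x
        y≤x η 0<η = N′ , λ n N′≤n → ℚ.≤-trans (y≤x-at n N′≤n)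
          (ℚ.≤-trans (ℚ.≤-reflexive (sym (ℚ.+-identityʳ _))) (ℚ.+-monoʳ-≤ (seq x n) (ℚ.<⇒≤ 0<η)))
          where
          cancel : ∀ a e → a + e - e ≡ a
          cancel = solve 2 (λ a e → a :+ e :+ (:- e) := a) refl
            where open +-*-Solver
          y≤x-at : ∀ n → N′ ℕ.≤ n → seq y n ≤ seq x n
          y≤x-at n N′≤n = subst₂ _≤_ (cancel (seq y n) ε′) (cancel (seq x n) ε′) (ℚ.+-monoˡ-≤ (- ε′) (begin
            seq y n + ε′         ≤⟨ ℚ.+-monoˡ-≤ ε′ (∣p-q∣<δ⇒p≤q+δ (seq y n) (seq y N′) (q n N′ (ℕ.≤-trans N≤ N′≤n) N≤)) ⟩
            seq y N′ + ε′ + ε′   ≡⟨ trans (ℚ.+-assoc (seq y N′) ε′ ε′) (cong (seq y N′ +_) (½*+½* (½ * δ))) ⟩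
            seq y N′ + ½ * δ     ≤⟨ h ⟩
            seq x N′             ≤⟨ ∣p-q∣<δ⇒p≤q+δ (seq x N′) (seq x n) (p N′ n M≤ (ℕ.≤-trans M≤ N′≤n)) ⟩
            seq x n + ε′         ∎))

  weak-minimum : ∀ {A : Set} (w : A → ℝ) a as → ¬ ¬ (∃[ m ] (m ∈ a ∷ as × All (λ b → w m ≤ᴿ w b) (a ∷ as)))
  weak-minimum w a []       k = k (a , here refl , ≤ᴿ-refl (w a) ∷ [])
  weak-minimum w a (b ∷ bs) k = weak-minimum w b bs λ { (m , m∈ , m≤) →
    ≤ᴿ-weakly-total (w a) (w m) λ
      { (inj₁ a≤m) → k (a , here refl , ≤ᴿ-refl (w a) ∷ All.map (λ {c} → ≤ᴿ-trans {w a} {w m} {w c} a≤m) m≤)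
      ; (inj₂ m≤a) → k (m , there m∈ , m≤a ∷ m≤) } }

  -- `P` need not be decidable: without a least element, strong induction refutes `P` everywhere.
  weak-least : (P : ℕ → Set) → ∀ {n} → P n → ¬ ¬ (∃[ k ] (P k × (∀ j → P j → k ℕ.≤ j)))
  weak-least P {n} Pn ¬least = <-rec (¬_ ∘ P)
    (λ k ¬P<k Pk → ¬least (k , Pk , λ j Pj → ℕ.≮⇒≥ λ j<k → ¬P<k j<k Pj)) n Pn

  -- Layered graphs

  module Layered {d n : ℕ} (G : ParamGraph d n)
    (rank : Fin n → ℕ)
    (rank-edge : ∀ {u v} → ParamGraph.Edge G u v → rank v ≡ suc (rank u)) where

    open ParamGraph G

    acyclic : Acyclic
    acyclic v c = ℕ.<-irrefl refl (rank-< c)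
      where
      rank-< : ∀ {u v} → TransClosure Edge u v → rank u ℕ.< rank v
      rank-< [ e ]   = ℕ.≤-reflexive (sym (rank-edge e))
      rank-< (e ∷ c) = ℕ.<-trans (ℕ.≤-reflexive (sym (rank-edge e))) (rank-< c)

    rank-vertices : ∀ {u v} (p : Walk u v) → All (λ w → rank u ℕ.≤ rank w) (vertices p)
    rank-vertices ε       = ℕ.≤-refl ∷ []
    rank-vertices (e ◅ p) = ℕ.≤-refl ∷ All.map (ℕ.≤-trans (ℕ.<⇒≤ (ℕ.≤-reflexive (sym (rank-edge e))))) (rank-vertices p)

    walk-isPath : ∀ {u v} (p : Walk u v) → IsPath p
    walk-isPath ε       = [] ∷ []
    walk-isPath {u} (e ◅ p) = All.map distinct (rank-vertices p) ∷ walk-isPath p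
      where
      distinct : ∀ {w} → rank _ ℕ.≤ rank w → u ≢ w
      distinct h refl = ℕ.<-irrefl refl (ℕ.≤-trans (ℕ.≤-reflexive (sym (rank-edge e))) h)

    rank-walk : ∀ {u v} → Walk u v → rank u ℕ.≤ rank v
    rank-walk ε       = ℕ.≤-refl
    rank-walk (e ◅ p) = ℕ.≤-trans (ℕ.<⇒≤ (ℕ.≤-reflexive (sym (rank-edge e)))) (rank-walk p)

    _≟ʷ_ : ∀ {u v} → DecidableEquality (Walk u v)
    ε ≟ʷ ε = yes refl
    ε ≟ʷ (_ ◅ _) = no λ ()
    (_ ◅ _) ≟ʷ ε = no λ ()
    (_◅_ {j = w} e p) ≟ʷ (_◅_ {j = w′} e′ q) with w Fin.≟ w′
    ... | no w≢w′ = no λ { refl → w≢w′ refl }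
    ... | yes refl with p ≟ʷ q
    ...   | no p≢q = no λ { refl → p≢q refl }
    ...   | yes refl = yes (cong (_◅ p) (T-irrelevant e e′))

    -- The number is fuel. Each edge raises the rank by one, so the difference of the ranks of the
    -- endpoints is enough to list all walks.
    walks : ℕ → ∀ u v → List (Walk u v)
    extend : ℕ → ∀ u v w → List (Walk u v)

    walks zero    u v with u Fin.≟ v
    ... | yes refl = ε ∷ []
    ... | no  _    = []
    walks (suc k) u v with u Fin.≟ v
    ... | yes refl = ε ∷ concatMap (extend k u v) (allFin n)
    ... | no  _    = concatMap (extend k u v) (allFin n)

    extend k u v w with T? (adj u w)
    ... | yes e = map (e ◅_) (walks k w v)
    ... | no  _ = []

    ∈-walks : ∀ k {u v} (p : Walk u v) → rank v ℕ.≤ k ℕ.+ rank u → p ∈ walks k u v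
    ∈-extend : ∀ k {u v w} (e : Edge u w) (p : Walk w v) → rank v ℕ.≤ k ℕ.+ rank w → (e ◅ p) ∈ extend k u v w

    ∈-walks zero {u} ε _ with u Fin.≟ u
    ... | yes refl = here refl
    ... | no  u≢u  = contradiction refl u≢u
    ∈-walks (suc k) {u} ε _ with u Fin.≟ u
    ... | yes refl = here refl
    ... | no  u≢u  = contradiction refl u≢u
    ∈-walks zero (e ◅ p) h = contradiction (ℕ.≤-trans (rank-walk p) h)
      (ℕ.<⇒≱ (ℕ.≤-reflexive (sym (rank-edge e))))
    ∈-walks (suc k) {u} {v} (_◅_ {j = w} e p) h with u Fin.≟ v
    ... | yes refl = contradiction (rank-walk p) (ℕ.<⇒≱ (ℕ.≤-reflexive (sym (rank-edge e))))
    ... | no  _    = ∈-concatMap⁺ (extend k u v) (Any.map (λ { refl → ∈-extend k e p h′ }) (∈-allFin w))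
      where
      h′ : rank v ℕ.≤ k ℕ.+ rank w
      h′ = ℕ.≤-trans h (ℕ.≤-reflexive (trans (sym (ℕ.+-suc k (rank u))) (cong (k ℕ.+_) (sym (rank-edge e)))))

    ∈-extend k {u} {v} {w} e p h with T? (adj u w)
    ... | yes e′ = subst (λ e → (e ◅ p) ∈ map (e′ ◅_) (walks k w v)) (T-irrelevant e′ e) (∈-map⁺ (e′ ◅_) (∈-walks k p h))
    ... | no ¬e  = contradiction e ¬e

    -- The list of all walks is itself a cover, so some length is attained; being a cover is not
    -- decidable, hence `weak-least`.
    mspc-exists : Walk source sink → ¬ ¬ (∃[ S ] IsMSPC S)
    mspc-exists p₀ ¬mspc =
      weak-least (λ k → ∃[ S ] (IsCover S × length S ≡ k)) (all , all-cover , refl) λ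
        { (k , (S , S-cover , refl) , least) → ¬mspc (S , record
            { isCover = S-cover
            ; minimum = λ S′ S′-cover → least (length S′) (S′ , S′-cover , refl) }) }
      where
      all : List (Walk source sink)
      all = deduplicate _≟ʷ_ (walks (rank sink) source sink)
      complete : ∀ p → p ∈ all
      complete p = ∈-deduplicate⁺ _≟ʷ_ (∈-walks (rank sink) p (ℕ.m≤m+n _ _))
      minimum : ∀ x S → (∀ p → p ∈ S) → ¬ ¬ (∃[ p ] (p ∈ S × IsShortest x p))
      minimum x []      c = contradiction (c p₀) λ ()
      minimum x (p ∷ S) c k = weak-minimum (weight x) p S λ { (m , m∈ , m≤) →
        k (m , m∈ , walk-isPath m , λ q _ → All.lookup m≤ (c q)) }
      all-cover : IsCover all
      all-cover = record
        { distinct = deduplicate-! _≟ʷ_ (walks (rank sink) source sink)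
        ; paths    = All.universal walk-isPath all
        ; covers   = λ x → minimum x all complete
        }

    -- Membership in `S` is decidable, which removes the double negation in `covers`: each `w i`
    -- really occurs in `S`, and distinct walks occupy distinct positions.
    cover-size : ∀ {N} (x : Fin N → Vector ℝ d) (w : Fin N → Walk source sink) →
      (∀ {i j} → w i ≡ w j → i ≡ j) → (∀ i p → IsShortest (x i) p → p ≡ w i) →
      ∀ S → IsCover S → N ℕ.≤ length S
    cover-size x w w-injective unique S cover = Fin.injective⇒≤ {f = position} λ {i} {j} eq →
      w-injective (trans (lookup-index (w∈S i)) (trans (cong (lookup S) eq) (sym (lookup-index (w∈S j)))))
      where
      open DecMembership _≟ʷ_ using (_∈?_)
      w∈S : ∀ i → w i ∈ S
      w∈S i = decidable-stable (w i ∈? S) λ w∉S → IsCover.covers cover (x i) λ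
        { (p , p∈S , p-shortest) → w∉S (subst (_∈ S) (unique i p p-shortest) p∈S) }
      position : Fin _ → Fin (length S)
      position i = Any.index (w∈S i)

-- Integers among the constructive reals.

module IntegerWeights where

  open import Data.Rational.Base as ℚ using (0ℚ; 1ℚ; ½; -_; _+_; _*_; _≤_)
  open import Data.Rational.Literals using (fromℤ)
  import Data.Rational.Properties as ℚ
  import Data.Rational.Unnormalised.Base as ℚᵘ
  import Data.Rational.Unnormalised.Properties as ℚᵘ
  open import Relation.Nullary.Decidable using (from-yes; from-no)

  fromℤ-+ : ∀ i j → fromℤ (i ℤ.+ j) ≡ fromℤ i + fromℤ j
  fromℤ-+ i j = ℚ.toℚᵘ-injective (ℚᵘ.≃-trans
    (ℚᵘ.*≡* (cong (ℤ._* 1ℤ) (sym (cong₂ ℤ._+_ (ℤ.*-identityʳ i) (ℤ.*-identityʳ j)))))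
    (ℚᵘ.≃-sym (ℚ.toℚᵘ-homo-+ (fromℤ i) (fromℤ j))))

  fromℤ-* : ∀ i j → fromℤ (i ℤ.* j) ≡ fromℤ i * fromℤ j
  fromℤ-* i j = ℚ.toℚᵘ-injective (ℚᵘ.≃-sym (ℚ.toℚᵘ-homo-* (fromℤ i) (fromℤ j)))

  fromℤ-mono-≤ : ∀ {i j} → i ℤ.≤ j → fromℤ i ≤ fromℤ j
  fromℤ-mono-≤ i≤j = ℚ.*≤* (ℤ.*-monoʳ-≤-nonNeg 1ℤ i≤j)

  -- Integers that are out of order differ by at least 1, so a tolerance of one half is harmless.
  fromℤ-½ : ∀ i j → fromℤ i ≤ fromℤ j + ½ → i ℤ.≤ j
  fromℤ-½ i j h with i ℤ.≤? j
  ... | yes i≤j = i≤j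
  ... | no  i≰j = contradiction 1≤½ (from-no (1ℚ ℚ.≤? ½))
    where
    open ℚ.≤-Reasoning
    cancel : ∀ x y → - x + (x + y) ≡ y
    cancel x y = trans (sym (ℚ.+-assoc (- x) x y)) (trans (cong (_+ y) (ℚ.+-inverseˡ x)) (ℚ.+-identityˡ y))
    1≤½ : 1ℚ ≤ ½
    1≤½ = subst₂ _≤_ (cancel (fromℤ j) 1ℚ) (cancel (fromℤ j) ½) (ℚ.+-monoʳ-≤ (- fromℤ j) (begin
      fromℤ j + 1ℚ       ≡⟨ fromℤ-+ j 1ℤ ⟨
      fromℤ (j ℤ.+ 1ℤ)   ≡⟨ cong fromℤ (ℤ.+-comm j 1ℤ) ⟩
      fromℤ (ℤ.suc j)    ≤⟨ fromℤ-mono-≤ (ℤ.i<j⇒suc[i]≤j (ℤ.≰⇒> i≰j)) ⟩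
      fromℤ i            ≤⟨ h ⟩
      fromℤ j + ½        ∎))

  infix 4 _≗ᴿ_

  -- The representing sequence is constant, equal to the given integer.
  _≗ᴿ_ : ℝ → ℤ → Set
  x ≗ᴿ i = ∀ k → seq x k ≡ fromℤ i

  ≤ᴿ⇒≤ : ∀ {x y i j} → x ≗ᴿ i → y ≗ᴿ j → x ≤ᴿ y → i ℤ.≤ j
  ≤ᴿ⇒≤ {i = i} {j} x≗i y≗j x≤y with x≤y ½ (from-yes (0ℚ ℚ.<? ½))
  ... | N , h = fromℤ-½ i j (subst₂ (λ p q → p ≤ q + ½) (x≗i N) (y≗j N) (h N ℕ.≤-refl))

  +ᴿ-≗ : ∀ {x y i j} → x ≗ᴿ i → y ≗ᴿ j → x +ᴿ y ≗ᴿ i ℤ.+ j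
  +ᴿ-≗ {i = i} {j} x≗i y≗j k = trans (cong₂ _+_ (x≗i k) (y≗j k)) (sym (fromℤ-+ i j))

  *ᴿ-≗ : ∀ {x y i j} → x ≗ᴿ i → y ≗ᴿ j → x *ᴿ y ≗ᴿ i ℤ.* j
  *ᴿ-≗ {i = i} {j} x≗i y≗j k = trans (cong₂ _*_ (x≗i k) (y≗j k)) (sym (fromℤ-* i j))

  ∑ᶠ : ∀ {d} → Vector ℤ d → ℤ
  ∑ᶠ = foldr ℤ._+_ 0ℤ

  ∑-≗ : ∀ {d} {f : Vector ℝ d} {g : Vector ℤ d} → (∀ i → f i ≗ᴿ g i) → ∑ f ≗ᴿ ∑ᶠ g
  ∑-≗ {zero}          f≗g k = refl
  ∑-≗ {suc d} {f} {g} f≗g = +ᴿ-≗ {f zero} {∑ (f ∘ suc)} (f≗g zero) (∑-≗ (f≗g ∘ suc))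

-- Layered graphs on exactly `n` vertices, with prescribed integer edge costs.

module Grids where

  open Chains using (∑<; ∑-empty; ∑-first; ∑-cong)
  open Covers
  open IntegerWeights
  open import Data.Nat.Base using (_+_; _*_; _≤_; _<_; _/_; _%_; _≡ᵇ_)
  open import Data.Nat.DivMod
  open import Data.Nat.Divisibility using (n∣m*n)
  open import Data.Rational.Literals using (fromℤ)
  open import Relation.Binary.Construct.Closure.Equivalence as Eq using (EqClosure)
  open import Relation.Binary.Construct.Closure.ReflexiveTransitive using (ε; _◅_; _◅◅_)
  open import Relation.Binary.Construct.Closure.Symmetric using (fwd; bwd)

  [m*n+o]/n≡m : ∀ m n {o} .{{_ : NonZero n}} → o < n → (m * n + o) / n ≡ m
  [m*n+o]/n≡m m n {o} o<n = trans (+-distrib-/-∣ˡ o (n∣m*n m))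
    (trans (cong₂ _+_ (m*n/n≡m m n) (m<n⇒m/n≡0 o<n)) (ℕ.+-identityʳ m))

  [m*n+o]%n≡o : ∀ m n {o} .{{_ : NonZero n}} → o < n → (m * n + o) % n ≡ o
  [m*n+o]%n≡o m n {o} o<n = trans (cong (_% n) (ℕ.+-comm (m * n) o))
    (trans ([m+kn]%n≡m%n o m n) (m<n⇒m%n≡m o<n))

  snoc : ∀ {A : Set} {d} → Vector A d → A → Vector A (suc d)
  snoc {d = zero}  f a i       = a
  snoc {d = suc d} f a zero    = f zero
  snoc {d = suc d} f a (suc i) = snoc (f ∘ suc) a i

  snoc-inject₁ : ∀ {A : Set} {d} (f : Vector A d) a i → snoc f a (inject₁ i) ≡ f i
  snoc-inject₁ f a zero    = refl
  snoc-inject₁ f a (suc i) = snoc-inject₁ (f ∘ suc) a i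

  snoc-fromℕ : ∀ {A : Set} {d} (f : Vector A d) a → snoc f a (fromℕ d) ≡ a
  snoc-fromℕ {d = zero}  f a = refl
  snoc-fromℕ {d = suc d} f a = snoc-fromℕ (f ∘ suc) a

  -- Quotient and remainder by `W` give layer and state, so every `n` is allowed: the vertices
  -- numbered beyond the sink lie in layers `D` and later and are on no walk to it. `wide` is what
  -- connects the vertices of layer 0 to each other.
  module LayeredGrid (d n W D : ℕ) .{{_ : NonZero W}} (0<n : 0 < n) (wide : W ≡ 1 ⊎ W < n) (DW<n : D * W < n)
    (slope : ℕ → ℕ → ℕ → Vector ℤ d) (intercept : ℕ → ℕ → ℕ → ℤ) where

    layer state : Fin n → ℕ
    layer v = toℕ v / W
    state v = toℕ v % W

    layer-state-injective : ∀ {u v} → layer u ≡ layer v → state u ≡ state v → u ≡ v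
    layer-state-injective {u} {v} l s = Fin.toℕ-injective
      (trans (m≡m%n+[m/n]*n (toℕ u) W) (trans (cong₂ (λ s l → s + l * W) s l) (sym (m≡m%n+[m/n]*n (toℕ v) W))))

    vertex : ∀ ℓ a → .(ℓ * W + a < n) → Fin n
    vertex ℓ a h = fromℕ< h

    layer-vertex : ∀ ℓ {a} .(h : ℓ * W + a < n) → a < W → layer (vertex ℓ a h) ≡ ℓ
    layer-vertex ℓ h a<W = trans (cong (_/ W) (Fin.toℕ-fromℕ< h)) ([m*n+o]/n≡m ℓ W a<W)

    state-vertex : ∀ ℓ {a} .(h : ℓ * W + a < n) → a < W → state (vertex ℓ a h) ≡ a
    state-vertex ℓ h a<W = trans (cong (_% W) (Fin.toℕ-fromℕ< h)) ([m*n+o]%n≡o ℓ W a<W)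

    adjacent : Fin n → Fin n → Bool
    adjacent u v = layer v ≡ᵇ suc (layer u)

    0<W : 0 < W
    0<W = ℕ.>-nonZero⁻¹ W

    start end : Fin n
    start = vertex 0 0 0<n
    end = vertex D 0 (subst (_< n) (sym (ℕ.+-identityʳ (D * W))) DW<n)

    -- Either layer 0 is a single vertex, or a vertex of layer 1 exists and is a common successor.
    connected-layer-0 : W ≡ 1 ⊎ W < n → ∀ v → layer v ≡ 0 → EqClosure (λ u v → T (adjacent u v)) v start
    connected-layer-0 (inj₁ W≡1) v l≡0 = subst (EqClosure _ v) v≡start ε
      where
      v≡start : v ≡ start
      v≡start = layer-state-injective (trans l≡0 (sym (layer-vertex 0 0<n 0<W)))
        (trans (ℕ.n<1⇒n≡0 (subst (state v <_) W≡1 (m%n<n (toℕ v) W))) (sym (state-vertex 0 0<n 0<W)))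
    connected-layer-0 (inj₂ W<n) v l≡0 = fwd (edge l≡0) ◅ bwd (edge (layer-vertex 0 0<n 0<W)) ◅ ε
      where
      h : 1 * W + 0 < n
      h = subst (_< n) (sym (trans (ℕ.+-identityʳ (1 * W)) (ℕ.*-identityˡ W))) W<n
      edge : ∀ {u} → layer u ≡ 0 → T (adjacent u (vertex 1 0 h))
      edge l≡0 = ℕ.≡⇒≡ᵇ _ _ (trans (layer-vertex 1 h 0<W) (cong suc (sym l≡0)))

    connected-start : ∀ ℓ v → layer v ≡ ℓ → EqClosure (λ u v → T (adjacent u v)) v start
    connected-start zero    = connected-layer-0 wide
    connected-start (suc ℓ) v l≡ = bwd edge ◅ connected-start ℓ w (layer-vertex ℓ h 0<W)
      where
      h : ℓ * W + 0 < n
      h = ℕ.≤-<-trans (begin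
        ℓ * W + 0      ≡⟨ ℕ.+-identityʳ (ℓ * W) ⟩
        ℓ * W          ≤⟨ ℕ.*-monoˡ-≤ W (ℕ.n≤1+n ℓ) ⟩
        suc ℓ * W      ≡⟨ cong (_* W) l≡ ⟨
        layer v * W    ≤⟨ m/n*n≤m (toℕ v) W ⟩
        toℕ v          ∎) (Fin.toℕ<n v)
        where open ℕ.≤-Reasoning
      w = vertex ℓ 0 h
      edge : T (adjacent w v)
      edge = ℕ.≡⇒≡ᵇ _ _ (trans l≡ (cong suc (sym (layer-vertex ℓ h 0<W))))

    grid : ParamGraph d n
    grid = record
      { adj       = adjacent
      ; loopless  = λ u e → ℕ.m≢1+n+m (layer u) {0} (ℕ.≡ᵇ⇒≡ _ _ e)
      ; connected = λ u v → connected-start _ u refl ◅◅ Eq.symmetric _ (connected-start _ v refl)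
      ; source    = start
      ; sink      = end
      ; coeff     = λ u v _ i → fromℚ (fromℤ (snoc (slope (layer u) (state u) (state v))
                                                   (intercept (layer u) (state u) (state v)) i))
      }

    open ParamGraph grid public

    rank-edge : ∀ {u v} → Edge u v → layer v ≡ suc (layer u)
    rank-edge {u} {v} = ℕ.≡ᵇ⇒≡ (layer v) (suc (layer u))

    open Layered grid layer (λ {u} {v} → rank-edge {u} {v}) public

    #_ : Vector ℤ d → Vector ℝ d
    (# X) i = fromℚ (fromℤ (X i))

    edgeCost : Vector ℤ d → ℕ → ℕ → ℕ → ℤ
    edgeCost X ℓ a b = ∑ᶠ (λ i → slope ℓ a b i ℤ.* X i) ℤ.+ intercept ℓ a b

    edgeWeight-≗ : ∀ X u v e → edgeWeight (# X) u v e ≗ᴿ edgeCost X (layer u) (state u) (state v)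
    edgeWeight-≗ X u v e = +ᴿ-≗ {∑ (λ i → coeff u v e (inject₁ i) *ᴿ (# X) i)} {coeff u v e (fromℕ d)}
      (∑-≗ λ i → *ᴿ-≗ {coeff u v e (inject₁ i)} {(# X) i}
        (λ k → cong fromℤ (snoc-inject₁ (slope (layer u) (state u) (state v)) _ i)) (λ k → refl))
      (λ k → cong fromℤ (snoc-fromℕ (slope (layer u) (state u) (state v)) _))

    steps : ∀ {u v} → Walk u v → ℕ
    steps ε       = 0
    steps (e ◅ p) = suc (steps p)

    layer-steps : ∀ {u v} (p : Walk u v) → layer u + steps p ≡ layer v
    layer-steps {u} ε = ℕ.+-identityʳ (layer u)
    layer-steps {u} (_◅_ {j = w} e p) = trans (ℕ.+-suc (layer u) (steps p))
      (trans (cong (_+ steps p) (sym (rank-edge {u} {w} e))) (layer-steps p))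

    stateAt : ∀ {u v} → Walk u v → ℕ → ℕ
    stateAt {u} ε       k       = state u
    stateAt {u} (e ◅ p) zero    = state u
    stateAt     (e ◅ p) (suc k) = stateAt p k

    stateAt-0 : ∀ {u v} (p : Walk u v) → stateAt p 0 ≡ state u
    stateAt-0 ε       = refl
    stateAt-0 (e ◅ p) = refl

    stateAt<W : ∀ {u v} (p : Walk u v) k → stateAt p k < W
    stateAt<W {u} ε       k       = m%n<n (toℕ u) W
    stateAt<W {u} (e ◅ p) zero    = m%n<n (toℕ u) W
    stateAt<W     (e ◅ p) (suc k) = stateAt<W p k

    cost : ∀ {u v} → Vector ℤ d → Walk u v → ℤ
    cost {u} X p = ∑< (steps p) (λ k → edgeCost X (layer u + k) (stateAt p k) (stateAt p (suc k)))

    weight-≗ : ∀ X {u v} (p : Walk u v) → weight (# X) p ≗ᴿ cost X p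
    weight-≗ X {u} ε k = cong fromℤ (sym (∑-empty (λ k → edgeCost X (layer u + k) (state u) (state u))))
    weight-≗ X {u} (_◅_ {j = w} e p) k = trans
      (+ᴿ-≗ {edgeWeight (# X) u w e} {weight (# X) p} (edgeWeight-≗ X u w e) (weight-≗ X p) k)
      (cong fromℤ (sym (trans (∑-first (steps p) (λ k → edgeCost X (layer u + k) (stateAt (e ◅ p) k) (stateAt p k)))
        (cong₂ ℤ._+_ (cong₂ (λ ℓ b → edgeCost X ℓ (state u) b) (ℕ.+-identityʳ (layer u)) (stateAt-0 p))
          (∑-cong (steps p) λ k _ → cong (λ ℓ → edgeCost X ℓ (stateAt p k) (stateAt p (suc k)))
            (trans (ℕ.+-suc (layer u) k) (cong (_+ k) (sym (rank-edge {u} {w} e)))))))))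

    shortest-cost : ∀ X p → IsShortest (# X) p → ∀ q → cost X p ℤ.≤ cost X q
    shortest-cost X p (_ , p≤) q =
      ≤ᴿ⇒≤ {weight (# X) p} {weight (# X) q} (weight-≗ X p) (weight-≗ X q) (p≤ q (walk-isPath q))

    -- The layers along a walk are forced and its ends are fixed, so only the states strictly in
    -- between can differ.
    walk-unique : ∀ {u v} (p q : Walk u v) → (∀ k → suc (layer u + k) < layer v → stateAt p (suc k) ≡ stateAt q (suc k)) → p ≡ q
    walk-unique ε ε h = refl
    walk-unique {u} ε (_◅_ {j = w} e q) h = contradiction (rank-walk q) (ℕ.<⇒≱ (ℕ.≤-reflexive (sym (rank-edge {u} {w} e))))
    walk-unique {u} (_◅_ {j = w} e p) ε h = contradiction (rank-walk p) (ℕ.<⇒≱ (ℕ.≤-reflexive (sym (rank-edge {u} {w} e))))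
    walk-unique {u} {v} (_◅_ {j = w} e p) (_◅_ {j = w′} e′ q) h with w≡w′
      where
      w≡v : ∀ {w} → Edge u w → Walk w v → ¬ suc (layer u + 0) < layer v → w ≡ v
      w≡v {w} e ε           ≮v = refl
      w≡v {w} e (_◅_ {j = z} e′ p) ≮v = contradiction (begin
        suc (suc (layer u + 0)) ≡⟨ cong (λ ℓ → suc (suc ℓ)) (ℕ.+-identityʳ (layer u)) ⟩
        suc (suc (layer u))     ≡⟨ cong suc (rank-edge {u} {w} e) ⟨
        suc (layer w)           ≡⟨ rank-edge {w} {z} e′ ⟨
        layer z                 ≤⟨ rank-walk p ⟩
        layer v                 ∎) ≮v
        where open ℕ.≤-Reasoning
      w≡w′ : w ≡ w′
      w≡w′ with suc (layer u + 0) ℕ.<? layer v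
      ... | yes <v = layer-state-injective (trans (rank-edge {u} {w} e) (sym (rank-edge {u} {w′} e′)))
                       (trans (sym (stateAt-0 p)) (trans (h 0 <v) (stateAt-0 q)))
      ... | no ≮v = trans (w≡v e p ≮v) (sym (w≡v e′ q ≮v))
    ... | refl = cong₂ _◅_ (T-irrelevant e e′) (walk-unique p q λ k lt →
      h (suc k) (subst (_< layer v) (cong suc (trans (cong (_+ k) (rank-edge {u} {w} e)) (sym (ℕ.+-suc (layer u) k)))) lt))

    layer-end : layer end ≡ D
    layer-end = layer-vertex D _ 0<W

    layer-start : layer start ≡ 0
    layer-start = layer-vertex 0 0<n 0<W

    -- c gives the intended state in each layer strictly between source and sink.
    module _ (c : ℕ → ℕ) (c<W : ∀ ℓ → c ℓ < W) where

      interior : ∀ {ℓ} → ℓ < D → ℓ * W + c ℓ < n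
      interior {ℓ} ℓ<D = ℕ.<-trans (ℕ.<-≤-trans (ℕ.+-monoʳ-< (ℓ * W) (c<W ℓ))
        (ℕ.≤-trans (ℕ.≤-reflexive (ℕ.+-comm (ℓ * W) W)) (ℕ.*-monoˡ-≤ W ℓ<D))) DW<n

      suc-layer<D : ∀ k u → layer u + suc (suc k) ≡ D → suc (layer u) < D
      suc-layer<D k u eq = subst (suc (layer u) <_) eq
        (subst (suc (layer u) <_) (sym (ℕ.+-suc (layer u) (suc k))) (s≤s (ℕ.m<m+n (layer u) (s≤s z≤n))))

      next : ∀ k u → layer u + suc (suc k) ≡ D → Fin n
      next k u eq = vertex (suc (layer u)) (c (suc (layer u))) (interior (suc-layer<D k u eq))

      layer-next : ∀ k u eq → layer (next k u eq) ≡ suc (layer u)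
      layer-next k u eq = layer-vertex (suc (layer u)) (interior (suc-layer<D k u eq)) (c<W _)

      layer-next+ : ∀ k u eq → layer (next k u eq) + suc k ≡ D
      layer-next+ k u eq =
        trans (cong (_+ suc k) (layer-next k u eq)) (trans (sym (ℕ.+-suc (layer u) (suc k))) eq)

      -- `k` counts the vertices still to come before the sink; the last edge goes to the sink
      -- whatever `c` says there.
      walkTo : ∀ k u → layer u + suc k ≡ D → Walk u sink
      walkTo zero    u eq = ℕ.≡⇒≡ᵇ _ _ (trans layer-end (trans (sym eq) (ℕ.+-comm (layer u) 1))) ◅ ε
      walkTo (suc k) u eq = ℕ.≡⇒≡ᵇ _ _ (layer-next k u eq) ◅ walkTo k (next k u eq) (layer-next+ k u eq)

      stateAt-walkTo : ∀ k u eq i → i < k → stateAt (walkTo k u eq) (suc i) ≡ c (suc (layer u + i))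
      stateAt-walkTo (suc k) u eq zero _ = trans (stateAt-0 (walkTo k (next k u eq) (layer-next+ k u eq)))
        (trans (state-vertex (suc (layer u)) (interior (suc-layer<D k u eq)) (c<W _))
               (cong (c ∘ suc) (sym (ℕ.+-identityʳ (layer u)))))
      stateAt-walkTo (suc k) u eq (suc i) (s≤s i<k) =
        trans (stateAt-walkTo k (next k u eq) (layer-next+ k u eq) i i<k)
          (cong (c ∘ suc) (trans (cong (_+ i) (layer-next k u eq)) (sym (ℕ.+-suc (layer u) i))))

-- One block per parameter, in series.

module BlocksInSeries where

  open Chains
  open IntegerWeights
  open Grids
  open import Data.Integer.Base using (+_; ∣_∣)
  open import Data.Integer.Tactic.RingSolver using (solve-∀)
  open import Data.Nat.Base using (_+_; _*_; _^_; _≤_; _<_; _/_; _%_; _≡ᵇ_)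
  open import Data.Nat.DivMod

  ∑-blocks : ∀ d L f → ∑< (d * L) f ≡ ∑< d (λ j → ∑< L (λ r → f (j * L + r)))
  ∑-blocks zero    L f = trans (∑-empty f) (sym (∑-empty _))
  ∑-blocks (suc d) L f = trans (∑-split L (d * L) f)
    (trans (cong (ℤ._+_ (∑< L f)) (trans (∑-blocks d L (λ i → f (L + i)))
             (∑-cong d λ j _ → ∑-cong L λ r _ → cong f (sym (ℕ.+-assoc L (j * L) r)))))
           (sym (∑-first d _)))

  ∑-mono-≤ : ∀ d {f g : ℕ → ℤ} → (∀ j → j < d → f j ℤ.≤ g j) → ∑< d f ℤ.≤ ∑< d g
  ∑-mono-≤ zero    {f} {g} f≤g = ℤ.≤-reflexive (trans (∑-empty f) (sym (∑-empty g)))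
  ∑-mono-≤ (suc d) {f} {g} f≤g = subst₂ ℤ._≤_ (sym (∑-first d f)) (sym (∑-first d g))
    (ℤ.+-mono-≤ (f≤g 0 (s≤s z≤n)) (∑-mono-≤ d λ j j<d → f≤g (suc j) (s≤s j<d)))

  -- A strict inequality in one term could not be made up by the others. With block minima for `f`
  -- and the energies of a shortest path for `g`, this localises optimality to each block.
  ∑-tight : ∀ d {f g : ℕ → ℤ} → (∀ j → j < d → f j ℤ.≤ g j) → ∑< d g ℤ.≤ ∑< d f → ∀ j → j < d → g j ℤ.≤ f j
  ∑-tight (suc d) {f} {g} f≤g ∑g≤∑f = go
    where
    open ℤ.≤-Reasoning
    F = ∑< d (f ∘ suc)
    G = ∑< d (g ∘ suc)
    tail : F ℤ.≤ G
    tail = ∑-mono-≤ d λ j j<d → f≤g (suc j) (s≤s j<d)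
    sums : g 0 ℤ.+ G ℤ.≤ f 0 ℤ.+ F
    sums = subst₂ ℤ._≤_ (∑-first d g) (∑-first d f) ∑g≤∑f
    cancel : ∀ a b → a ℤ.+ b ℤ.- b ≡ a
    cancel = solve-∀
    cancelˡ : ∀ a b → ℤ.- a ℤ.+ (a ℤ.+ b) ≡ b
    cancelˡ = solve-∀
    go : ∀ j → j < suc d → g j ℤ.≤ f j
    go zero    _         = subst₂ ℤ._≤_ (cancel (g 0) G) (cancel (f 0) G)
      (ℤ.+-monoˡ-≤ (ℤ.- G) (ℤ.≤-trans sums (ℤ.+-monoʳ-≤ (f 0) tail)))
    go (suc j) (s≤s j<d) = ∑-tight d (λ j j<d → f≤g (suc j) (s≤s j<d))
      (subst₂ ℤ._≤_ (cancelˡ (f 0) G) (cancelˡ (f 0) F)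
        (ℤ.+-monoʳ-≤ (ℤ.- f 0) (ℤ.≤-trans (ℤ.+-monoˡ-≤ G (f≤g 0 (s≤s z≤n))) sums)))
      j j<d

  ∑ᶠ-zero : ∀ {d} (X : ℕ → ℤ) → ∑ᶠ {d} (λ i → 0ℤ ℤ.* X (toℕ i)) ≡ 0ℤ
  ∑ᶠ-zero {zero}  X = refl
  ∑ᶠ-zero {suc d} X = cong₂ ℤ._+_ (ℤ.*-zeroˡ (X 0)) (∑ᶠ-zero {d} (X ∘ suc))

  ∑ᶠ-select : ∀ d j s (X : ℕ → ℤ) → j < d →
    ∑ᶠ {d} (λ i → (if toℕ i ≡ᵇ j then s else 0ℤ) ℤ.* X (toℕ i)) ≡ s ℤ.* X j
  ∑ᶠ-select (suc d) zero    s X _         =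
    trans (cong (ℤ._+_ (s ℤ.* X 0)) (∑ᶠ-zero {d} (X ∘ suc))) (ℤ.+-identityʳ _)
  ∑ᶠ-select (suc d) (suc j) s X (s≤s j<d) =
    trans (cong₂ ℤ._+_ (ℤ.*-zeroˡ (X 0)) (∑ᶠ-select d j s (X ∘ suc) j<d)) (ℤ.+-identityˡ _)

  module Digits (A : ℕ) .{{_ : NonZero A}} where

    digit : ℕ → ℕ → ℕ
    digit N zero    = N % A
    digit N (suc t) = digit (N / A) t

    digit≤ : ∀ N t → digit N t ≤ A
    digit≤ N zero    = ℕ.<⇒≤ (m%n<n N A)
    digit≤ N (suc t) = digit≤ (N / A) t

    digit-injective : ∀ T {M N} → M < A ^ T → N < A ^ T → (∀ t → t < T → digit M t ≡ digit N t) → M ≡ N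
    digit-injective zero    {zero} {zero} _ _ _ = refl
    digit-injective zero    {suc _} (s≤s ())
    digit-injective zero    {zero} {suc _} _ (s≤s ())
    digit-injective (suc T) {M} {N} M< N< eq = begin
      M                    ≡⟨ m≡m%n+[m/n]*n M A ⟩
      M % A + (M / A) * A  ≡⟨ cong₂ (λ r q → r + q * A) (eq 0 (s≤s z≤n))
                                (digit-injective T (quotient< M<) (quotient< N<) λ t t<T → eq (suc t) (s≤s t<T)) ⟩
      N % A + (N / A) * A  ≡⟨ m≡m%n+[m/n]*n N A ⟨
      N                    ∎
      where
      open ≡-Reasoning
      quotient< : ∀ {M} → M < A ^ suc T → M / A < A ^ T
      quotient< {M} h = m<n*o⇒m/o<n (subst (M <_) (ℕ.*-comm A (A ^ T)) h)

  -- Removes the coupling of the last vertex of a block to the next block.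
  below : ℕ → ℕ → ℤ → ℤ
  below L r z with r ℕ.<? L
  ... | yes _ = z
  ... | no  _ = 0ℤ

  below-< : ∀ {L r} z → r < L → below L r z ≡ z
  below-< {L} {r} z r<L with r ℕ.<? L
  ... | yes _   = refl
  ... | no  r≮L = contradiction r<L r≮L

  below-end : ∀ L z → below L L z ≡ 0ℤ
  below-end L z with L ℕ.<? L
  ... | yes L<L = contradiction L<L (ℕ.<-irrefl refl)
  ... | no  _   = refl

  module _ (R : ℕ) where

    -- The states 0, …, 2R of a layer stand for the integers - R, …, R.
    height : ℕ → ℤ
    height a = + a ℤ.- + R

    height-bounded : ∀ a → a < suc (R + R) → ∣ height a ∣ ≤ R
    height-bounded a (s≤s a≤2R) with ℕ.≤-total R a
    ... | inj₁ R≤a = ℕ.≤-trans (ℕ.≤-reflexive (cong ∣_∣ (trans (ℤ.m-n≡m⊖n a R) (ℤ.⊖-≥ R≤a))))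
                       (ℕ.m≤n+o⇒m∸n≤o a R a≤2R)
    ... | inj₂ a≤R = ℕ.≤-trans (ℕ.≤-reflexive (trans (cong ∣_∣ (ℤ.m-n≡m⊖n a R)) (ℤ.∣⊖∣-≤ a≤R))) (ℕ.m∸n≤m R a)

    encode : ℤ → ℕ
    encode z = ∣ z ℤ.+ + R ∣

    encode-bounded : ∀ {z} → ∣ z ∣ ≤ R → encode z < suc (R + R)
    encode-bounded {z} z≤R = s≤s (ℕ.≤-trans (ℤ.∣i+j∣≤∣i∣+∣j∣ z (+ R)) (ℕ.+-monoˡ-≤ R z≤R))

    height-encode : ∀ {z} → ∣ z ∣ ≤ R → height (encode z) ≡ z
    height-encode {z} z≤R = trans (cong (ℤ._- + R) (ℤ.0≤i⇒+∣i∣≡i 0≤z+R)) (cancel z (+ R))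
      where
      cancel : ∀ a b → a ℤ.+ b ℤ.- b ≡ a
      cancel = solve-∀
      negated : ∀ a b → b ℤ.- a ≡ ℤ.- a ℤ.+ b
      negated = solve-∀
      -z≤R : ℤ.- z ℤ.≤ + R
      -z≤R = ℤ.≤-trans (i≤+∣i∣ (ℤ.- z)) (ℤ.+≤+ (ℕ.≤-trans (ℕ.≤-reflexive (ℤ.∣-i∣≡∣i∣ z)) z≤R))
      0≤z+R : 0ℤ ℤ.≤ z ℤ.+ + R
      0≤z+R = subst (0ℤ ℤ.≤_) (lemma z (+ R)) (ℤ.i≤j⇒0≤j-i -z≤R)
        where
        lemma : ∀ z r → r ℤ.- ℤ.- z ≡ z ℤ.+ r
        lemma = solve-∀

    encode-height : ∀ a → encode (height a) ≡ a
    encode-height a = cong ∣_∣ (cancel (+ a) (+ R))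
      where
      cancel : ∀ a b → a ℤ.- b ℤ.+ b ≡ a
      cancel = solve-∀

  -- d blocks of level m, the j-th priced at the j-th parameter.  Layer 0 is the
  -- source layer, and block j occupies the layers j * L + 1, …, (j + 1) * L.
  module Series (d n m A : ℕ) .{{_ : NonZero A}} where

    R W : ℕ
    R = suc m * A
    W = suc (R + R)

    open Hierarchy R
    open Digits A

    B = level m
    L D : ℕ
    L = size B
    D = suc (d * L)

    -- The price of a layer is charged to the edge leaving it, since the coupling involves both
    -- ends. Edges leaving layer 0 are free, hence the index shift.
    slope : ℕ → ℕ → ℕ → Vector ℤ d
    slope zero    a b j = 0ℤ
    slope (suc i) a b j = if toℕ j ≡ᵇ i / L then ℤ.- (+ 2) ℤ.* (σ B (i % L) ℤ.* height R a) else 0ℤ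

    intercept : ℕ → ℕ → ℕ → ℤ
    intercept zero    a b = 0ℤ
    intercept (suc i) a b = α B (i % L) ℤ.* (height R a ℤ.* height R a)
      ℤ.+ γ B (i % L) ℤ.* (height R a ℤ.* below L (suc (i % L)) (height R b))

    module _ (0<n : 0 < n) (W<n : W < n) (DW<n : D * W < n) where

      open LayeredGrid d n W D {{ℕ.nonZero}} 0<n (inj₂ W<n) DW<n slope intercept

      -- The state after each block is read as 0, in agreement with the coupling dropped in
      -- `intercept`; so the blocks are independent.
      profile : Walk source sink → ℕ → ℕ → ℤ
      profile p j r = below L r (height R (stateAt p (suc (j * L + r))))

      profile-bounded : ∀ p j r → ∣ profile p j r ∣ ≤ R
      profile-bounded p j r with r ℕ.<? L
      ... | yes _ = height-bounded R _ (stateAt<W p (suc (j * L + r)))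
      ... | no  _ = z≤n

      profile-end : ∀ p j → profile p j L ≡ 0ℤ
      profile-end p j = below-end L _

      edge-term : ℤ → (ℕ → ℤ) → ℕ → ℤ
      edge-term x y r = ℤ.- (+ 2) ℤ.* (σ B r ℤ.* y r) ℤ.* x ℤ.+ (α B r ℤ.* (y r ℤ.* y r) ℤ.+ γ B r ℤ.* (y r ℤ.* y (suc r)))

      energy-∑ : ∀ x y → energy B x y ≡ ∑< L (edge-term x y)
      energy-∑ x y = sym (begin
        ∑< L (edge-term x y)
          ≡⟨ ∑-cong L (λ r _ → lemma x (σ B r ℤ.* y r) (α B r ℤ.* (y r ℤ.* y r)) (γ B r ℤ.* (y r ℤ.* y (suc r)))) ⟩
        ∑< L (λ r → 1ℤ ℤ.* (1ℤ ℤ.* (α B r ℤ.* (y r ℤ.* y r)) ℤ.+ 1ℤ ℤ.* (γ B r ℤ.* (y r ℤ.* y (suc r))))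
                      ℤ.+ ℤ.- (+ 2 ℤ.* x) ℤ.* (σ B r ℤ.* y r))
          ≡⟨ ∑-linear L 1ℤ (ℤ.- (+ 2 ℤ.* x)) (λ r → 1ℤ ℤ.* (α B r ℤ.* (y r ℤ.* y r)) ℤ.+ 1ℤ ℤ.* (γ B r ℤ.* (y r ℤ.* y (suc r)))) (λ r → σ B r ℤ.* y r) ⟩
        1ℤ ℤ.* ∑< L (λ r → 1ℤ ℤ.* (α B r ℤ.* (y r ℤ.* y r)) ℤ.+ 1ℤ ℤ.* (γ B r ℤ.* (y r ℤ.* y (suc r))))
          ℤ.+ ℤ.- (+ 2 ℤ.* x) ℤ.* lin B y
          ≡⟨ cong (λ s → 1ℤ ℤ.* s ℤ.+ ℤ.- (+ 2 ℤ.* x) ℤ.* lin B y)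
               (∑-linear L 1ℤ 1ℤ (λ r → α B r ℤ.* (y r ℤ.* y r)) (λ r → γ B r ℤ.* (y r ℤ.* y (suc r)))) ⟩
        1ℤ ℤ.* (1ℤ ℤ.* Q ℤ.+ 1ℤ ℤ.* C) ℤ.+ ℤ.- (+ 2 ℤ.* x) ℤ.* lin B y
          ≡⟨ lemma′ x (lin B y) Q C ⟩
        energy B x y ∎)
        where
        open ≡-Reasoning
        Q = ∑< L (λ r → α B r ℤ.* (y r ℤ.* y r))
        C = ∑< L (λ r → γ B r ℤ.* (y r ℤ.* y (suc r)))
        lemma : ∀ x s a g → ℤ.- (+ 2) ℤ.* s ℤ.* x ℤ.+ (a ℤ.+ g)
          ≡ 1ℤ ℤ.* (1ℤ ℤ.* a ℤ.+ 1ℤ ℤ.* g) ℤ.+ ℤ.- (+ 2 ℤ.* x) ℤ.* s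
        lemma = solve-∀
        lemma′ : ∀ x l q c → 1ℤ ℤ.* (1ℤ ℤ.* q ℤ.+ 1ℤ ℤ.* c) ℤ.+ ℤ.- (+ 2 ℤ.* x) ℤ.* l ≡ q ℤ.+ c ℤ.- + 2 ℤ.* x ℤ.* l
        lemma′ = solve-∀

      edgeCost-block : ∀ (X : ℕ → ℤ) p j r → j < d → r < L →
        edgeCost (X ∘ toℕ) (suc (j * L + r)) (stateAt p (suc (j * L + r))) (stateAt p (suc (suc (j * L + r))))
          ≡ edge-term (X j) (profile p j) r
      edgeCost-block X p j r j<d r<L = cong₂ ℤ._+_
        (begin
          ∑ᶠ {d} (λ t → (if toℕ t ≡ᵇ (j * L + r) / L then ℤ.- (+ 2) ℤ.* (σ B ((j * L + r) % L) ℤ.* h) else 0ℤ) ℤ.* X (toℕ t))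
            ≡⟨ cong₂ (λ q s → ∑ᶠ {d} (λ t → (if toℕ t ≡ᵇ q then ℤ.- (+ 2) ℤ.* (σ B s ℤ.* h) else 0ℤ) ℤ.* X (toℕ t))) quotient remainder ⟩
          ∑ᶠ {d} (λ t → (if toℕ t ≡ᵇ j then ℤ.- (+ 2) ℤ.* (σ B r ℤ.* h) else 0ℤ) ℤ.* X (toℕ t))
            ≡⟨ ∑ᶠ-select d j _ X j<d ⟩
          ℤ.- (+ 2) ℤ.* (σ B r ℤ.* h) ℤ.* X j
            ≡⟨ cong (λ z → ℤ.- (+ 2) ℤ.* (σ B r ℤ.* z) ℤ.* X j) h≡ ⟩
          ℤ.- (+ 2) ℤ.* (σ B r ℤ.* profile p j r) ℤ.* X j ∎)
        (begin
          α B ((j * L + r) % L) ℤ.* (h ℤ.* h) ℤ.+ γ B ((j * L + r) % L) ℤ.* (h ℤ.* below L (suc ((j * L + r) % L)) h′)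
            ≡⟨ cong (λ s → α B s ℤ.* (h ℤ.* h) ℤ.+ γ B s ℤ.* (h ℤ.* below L (suc s) h′)) remainder ⟩
          α B r ℤ.* (h ℤ.* h) ℤ.+ γ B r ℤ.* (h ℤ.* below L (suc r) h′)
            ≡⟨ cong₂ (λ z z′ → α B r ℤ.* (z ℤ.* z) ℤ.+ γ B r ℤ.* (z ℤ.* z′)) h≡
                 (cong (λ k → below L (suc r) (height R (stateAt p (suc k)))) (sym (ℕ.+-suc (j * L) r))) ⟩
          α B r ℤ.* (profile p j r ℤ.* profile p j r) ℤ.+ γ B r ℤ.* (profile p j r ℤ.* profile p j (suc r)) ∎)
        where
        open ≡-Reasoning
        quotient = [m*n+o]/n≡m j L r<L
        remainder = [m*n+o]%n≡o j L r<L
        h = height R (stateAt p (suc (j * L + r)))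
        h′ = height R (stateAt p (suc (suc (j * L + r))))
        h≡ : h ≡ profile p j r
        h≡ = sym (below-< h r<L)

      steps≡D : (p : Walk source sink) → steps p ≡ D
      steps≡D p = trans (cong (_+ steps p) (sym layer-start)) (trans (layer-steps p) layer-end)

      cost-blocks : ∀ X (p : Walk source sink) → cost (X ∘ toℕ) p ≡ ∑< d (λ j → energy B (X j) (profile p j))
      cost-blocks X p = begin
        ∑< (steps p) (λ k → edgeCost (X ∘ toℕ) (layer start + k) (stateAt p k) (stateAt p (suc k)))
          ≡⟨ cong (λ N → ∑< N (λ k → edgeCost (X ∘ toℕ) (layer start + k) (stateAt p k) (stateAt p (suc k)))) (steps≡D p) ⟩
        ∑< D (λ k → edgeCost (X ∘ toℕ) (layer start + k) (stateAt p k) (stateAt p (suc k)))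
          ≡⟨ ∑-cong D (λ k _ → cong (λ l → edgeCost (X ∘ toℕ) (l + k) (stateAt p k) (stateAt p (suc k))) layer-start) ⟩
        ∑< D (λ k → edgeCost (X ∘ toℕ) k (stateAt p k) (stateAt p (suc k)))
          ≡⟨ ∑-first (d * L) _ ⟩
        edgeCost (X ∘ toℕ) 0 (stateAt p 0) (stateAt p 1)
          ℤ.+ ∑< (d * L) (λ i → edgeCost (X ∘ toℕ) (suc i) (stateAt p (suc i)) (stateAt p (suc (suc i))))
          ≡⟨ cong₂ ℤ._+_ (trans (ℤ.+-identityʳ _) (∑ᶠ-zero {d} X))
               (∑-blocks d L (λ i → edgeCost (X ∘ toℕ) (suc i) (stateAt p (suc i)) (stateAt p (suc (suc i))))) ⟩
        0ℤ ℤ.+ ∑< d (λ j → ∑< L (λ r → edgeCost (X ∘ toℕ) (suc (j * L + r)) (stateAt p (suc (j * L + r))) (stateAt p (suc (suc (j * L + r))))))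
          ≡⟨ ℤ.+-identityˡ _ ⟩
        ∑< d (λ j → ∑< L (λ r → edgeCost (X ∘ toℕ) (suc (j * L + r)) (stateAt p (suc (j * L + r))) (stateAt p (suc (suc (j * L + r))))))
          ≡⟨ ∑-cong d (λ j j<d → trans (∑-cong L λ r r<L → edgeCost-block X p j r j<d r<L)
                                       (sym (energy-∑ (X j) (profile p j)))) ⟩
        ∑< d (λ j → energy B (X j) (profile p j)) ∎
        where open ≡-Reasoning

      -- A number below `A ^ (d * suc m)` is an array of `d` rows of `suc m` base-`A` digits, one
      -- row per parameter.
      digits : ℕ → ℕ → ℕ → ℕ
      digits N j k = digit N (j * suc m + k)

      params : ℕ → ℕ → ℤ
      params N j = param (digits N j) m

      routes : ℕ → ℕ → ℕ → ℤ
      routes N j = route (digits N j) m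

      routes-bounded : ∀ N j r → ∣ routes N j r ∣ ≤ R
      routes-bounded N j r = route-bounded (digits N j) A (λ k → digit≤ N (j * suc m + k)) m r

      target : ℕ → ℕ → ℕ
      target N zero    = 0
      target N (suc i) = encode R (routes N (i / L) (i % L))

      target<W : ∀ N ℓ → target N ℓ < W
      target<W N zero    = s≤s z≤n
      target<W N (suc i) = encode-bounded R {routes N (i / L) (i % L)} (routes-bounded N (i / L) (i % L))

      walk : ℕ → Walk source sink
      walk N = walkTo (target N) (target<W N) (d * L) start (cong (_+ D) layer-start)

      stateAt-walk : ∀ N i → i < d * L → stateAt (walk N) (suc i) ≡ encode R (routes N (i / L) (i % L))
      stateAt-walk N i i<dL = trans (stateAt-walkTo (target N) (target<W N) (d * L) start _ i i<dL)
        (cong (λ l → target N (suc (l + i))) layer-start)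

      index< : ∀ j r → j < d → r < L → j * L + r < d * L
      index< j r j<d r<L = ℕ.<-≤-trans (ℕ.+-monoʳ-< (j * L) r<L)
        (ℕ.≤-trans (ℕ.≤-reflexive (ℕ.+-comm (j * L) L)) (ℕ.*-monoˡ-≤ L j<d))

      profile-walk : ∀ N j r → j < d → r < L → profile (walk N) j r ≡ routes N j r
      profile-walk N j r j<d r<L = begin
        profile (walk N) j r
          ≡⟨ below-< _ r<L ⟩
        height R (stateAt (walk N) (suc (j * L + r)))
          ≡⟨ cong (height R) (stateAt-walk N (j * L + r) (index< j r j<d r<L)) ⟩
        height R (encode R (routes N ((j * L + r) / L) ((j * L + r) % L)))
          ≡⟨ cong₂ (λ q s → height R (encode R (routes N q s))) ([m*n+o]/n≡m j L r<L) ([m*n+o]%n≡o j L r<L) ⟩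
        height R (encode R (routes N j r))
          ≡⟨ height-encode R (routes-bounded N j r) ⟩
        routes N j r ∎
        where open ≡-Reasoning

      walk-follows : ∀ N j → j < d → Follows B (routes N j) (profile (walk N) j)
      walk-follows N j j<d r r<L = trans (profile-walk N j r j<d r<L)
        (sym (trans (cong (ℤ._+ routes N j r) (profile-end (walk N) j)) (ℤ.+-identityˡ _)))

      minimal : ℕ → ℕ → ℤ
      minimal N j = least (digits N j) m 0ℤ

      cost-walk : ∀ N → cost (params N ∘ toℕ) (walk N) ≡ ∑< d (minimal N)
      cost-walk N = trans (cost-blocks (params N) (walk N)) (∑-cong d λ j j<d →
        trans (energy-follows (digits N j) m (profile (walk N) j) (walk-follows N j j<d))
              (cong (least (digits N j) m) (profile-end (walk N) j)))

      block-dichotomy : ∀ N p j → Follows B (routes N j) (profile p j)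
        ⊎ 1ℤ ℤ.+ minimal N j ℤ.≤ energy B (params N j) (profile p j)
      block-dichotomy N p j = subst (λ v → Follows B (routes N j) (profile p j) ⊎ 1ℤ ℤ.+ least (digits N j) m v ℤ.≤ energy B (params N j) (profile p j))
        (profile-end p j)
        (dichotomy (digits N j) A (λ k → digit≤ N (j * suc m + k)) m ℕ.≤-refl (profile p j) (profile-bounded p j))

      block-minimal : ∀ N p j → minimal N j ℤ.≤ energy B (params N j) (profile p j)
      block-minimal N p j with block-dichotomy N p j
      ... | inj₁ f = ℤ.≤-reflexive (sym (trans (energy-follows (digits N j) m (profile p j) f)
                                              (cong (least (digits N j) m) (profile-end p j))))
      ... | inj₂ h = ℤ.≤-trans (ℤ.i≤j+i _ 1ℤ) h

      -- The intended walk is minimal in every block at once, so by `∑-tight` a shortest path is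
      -- too; the gap in `block-dichotomy` then forces it onto the route of each block.
      unique-shortest : ∀ N p → IsShortest (# (params N ∘ toℕ)) p → p ≡ walk N
      unique-shortest N p p-shortest = walk-unique p (walk N) λ k k< →
        same-state k (ℕ.≤-pred (subst₂ _<_ (cong (λ l → suc (l + k)) layer-start) layer-end k<))
        where
        open ≡-Reasoning
        tight : ∀ j → j < d → energy B (params N j) (profile p j) ℤ.≤ minimal N j
        tight = ∑-tight d (λ j _ → block-minimal N p j)
          (subst₂ ℤ._≤_ (cost-blocks (params N) p) (cost-walk N)
            (shortest-cost (params N ∘ toℕ) p p-shortest (walk N)))
        p-follows : ∀ j → j < d → Follows B (routes N j) (profile p j)
        p-follows j j<d with block-dichotomy N p j
        ... | inj₁ f = f
        ... | inj₂ h = contradiction (ℤ.≤-trans h (tight j j<d)) (ℤ.<⇒≱ (ℤ.suc[i]≤j⇒i<j ℤ.≤-refl))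
        same-state : ∀ k → k < d * L → stateAt p (suc k) ≡ stateAt (walk N) (suc k)
        same-state k k<dL = begin
          stateAt p (suc k)
            ≡⟨ encode-height R _ ⟨
          encode R (height R (stateAt p (suc k)))
            ≡⟨ cong (λ i → encode R (height R (stateAt p (suc i)))) k≡ ⟩
          encode R (height R (stateAt p (suc (j * L + r))))
            ≡⟨ cong (encode R) (below-< _ r<L) ⟨
          encode R (profile p j r)
            ≡⟨ cong (encode R) (trans (p-follows j j<d r r<L)
                 (trans (cong (ℤ._+ routes N j r) (profile-end p j)) (ℤ.+-identityˡ (routes N j r)))) ⟩
          encode R (routes N j r)
            ≡⟨ stateAt-walk N k k<dL ⟨
          stateAt (walk N) (suc k) ∎
          where
          j = k / L
          r = k % L
          r<L = m%n<n k L
          j<d = m<n*o⇒m/o<n {k} {d} {L} k<dL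
          k≡ : k ≡ j * L + r
          k≡ = trans (m≡m%n+[m/n]*n k L) (ℕ.+-comm r (j * L))

      -- Digit `t` belongs to row `t / suc m` and column `t % suc m`, and is recovered from the
      -- route of that block.
      walk-injective : ∀ {M N} → M < A ^ (d * suc m) → N < A ^ (d * suc m) → walk M ≡ walk N → M ≡ N
      walk-injective {M} {N} M< N< eq = digit-injective (d * suc m) M< N< λ t t< →
        subst (λ k → digit M k ≡ digit N k) (sym (trans (m≡m%n+[m/n]*n t (suc m)) (ℕ.+-comm (t % suc m) _)))
          (route-injective (digits M (t / suc m)) (digits N (t / suc m)) m
            (λ r r<L → trans (sym (profile-walk M _ r (m<n*o⇒m/o<n {t} {d} {suc m} t<) r<L))
              (trans (cong (λ p → profile p (t / suc m) r) eq) (profile-walk N _ r (m<n*o⇒m/o<n {t} {d} {suc m} t<) r<L)))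
            (t % suc m) (ℕ.≤-pred (m%n<n t (suc m))))

      mspc-size : ∀ S → IsMSPC S → A ^ (d * suc m) ≤ length S
      mspc-size S mspc = cover-size (λ i → # (params (toℕ i) ∘ toℕ)) (walk ∘ toℕ)
        (λ {i} {j} eq → Fin.toℕ-injective (walk-injective (Fin.toℕ<n i) (Fin.toℕ<n j) eq))
        (λ i → unique-shortest (toℕ i)) S (IsMSPC.isCover mspc)

-- Choice of sizes and the asymptotic bound.

open Chains using (module Hierarchy)
open Grids
open BlocksInSeries
open import Data.Nat.Base using (_+_; _*_; _^_; _<_; _≤_)
open import Data.Nat.Tactic.RingSolver using (solve-∀)
open import Relation.Binary.Construct.Closure.ReflexiveTransitive using (ε)

-- `R` affects only the coefficients, so it may be chosen in terms of `m` and `A` without changing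
-- the number of layers.
length-level : ∀ R m → suc (Chains.size (Hierarchy.level R m)) ≡ 2 ^ suc m
length-level R zero    = refl
length-level R (suc m) = trans (lemma (Chains.size (Hierarchy.level R m))) (cong (2 *_) (length-level R m))
  where
  lemma : ∀ L → suc (suc (L + L)) ≡ 2 * suc L
  lemma = solve-∀

n<b^n : ∀ b n → n < suc (suc b) ^ n
n<b^n b zero    = s≤s z≤n
n<b^n b (suc n) = begin-strict
  suc n                              <⟨ s≤s (n<b^n b n) ⟩
  suc (B ^ n)                        ≤⟨ ℕ.+-monoˡ-≤ (B ^ n) (ℕ.m^n>0 B n) ⟩
  B ^ n + B ^ n                      ≤⟨ ℕ.+-monoʳ-≤ (B ^ n) (ℕ.m≤m+n (B ^ n) (b * B ^ n)) ⟩
  B ^ suc n                          ∎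
  where
  open ℕ.≤-Reasoning
  B = suc (suc b)

-- Lowers the exponent from `k` while `n < b ^ k` persists, so the first failure brackets `n`.
log-search : ∀ b n k → 0 < n → n < b ^ k → ∃[ M ] (b ^ M ≤ n × n < b ^ suc M)
log-search b n zero    0<n n<1 = contradiction n<1 (ℕ.≤⇒≯ 0<n)
log-search b n (suc k) 0<n n<  with b ^ k ℕ.≤? n
... | yes b^k≤n = k , b^k≤n , n<
... | no  b^k≰n = log-search b n k 0<n (ℕ.≰⇒> b^k≰n)

32^M≡[2^M]^5 : ∀ M → 32 ^ M ≡ (2 ^ M) ^ 5
32^M≡[2^M]^5 M = trans (ℕ.^-*-assoc 2 5 M) (trans (cong (2 ^_) (ℕ.*-comm 5 M)) (sym (ℕ.^-*-assoc 2 M 5)))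

-- With `A = 2 ^ M` the grid has at most `(d + 1) * A` layers of width at most `2 * A * A`. Both
-- `d + 1` and 2 are at most `A`, which gives `A ^ 5`, the origin of the base 32.
grid-fits : ∀ d L M → suc L ≡ 2 ^ M → d + 2 ≤ M →
  suc (d * L) * suc (M * 2 ^ M + M * 2 ^ M) < 32 ^ M
grid-fits d L M sucL≡A d+2≤M = begin-strict
  suc (d * L) * suc (M * A + M * A)
    ≤⟨ ℕ.*-mono-≤ length≤ width≤ ⟩
  suc d * A * (A * A + A * A)
    ≡⟨ lemma (suc d) A ⟩
  suc d * (2 * (A * A * A))
    <⟨ ℕ.*-monoˡ-< (2 * (A * A * A)) {{ℕ.m*n≢0 2 (A * A * A)}} d<A ⟩
  A * (2 * (A * A * A))
    ≤⟨ ℕ.*-monoʳ-≤ A (ℕ.*-monoˡ-≤ (A * A * A) 2≤A) ⟩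
  A * (A * (A * A * A))
    ≡⟨ trans (lemma′ A) (sym (32^M≡[2^M]^5 M)) ⟩
  32 ^ M ∎
  where
  open ℕ.≤-Reasoning
  A = 2 ^ M
  instance
    A-nonZero : NonZero A
    A-nonZero = ℕ.m^n≢0 2 M
    A²-nonZero : NonZero (A * A)
    A²-nonZero = ℕ.m*n≢0 A A
    A³-nonZero : NonZero (A * A * A)
    A³-nonZero = ℕ.m*n≢0 (A * A) A
  1≤A : 1 ≤ A
  1≤A = ℕ.m^n>0 2 M
  2≤A : 2 ≤ A
  2≤A = ℕ.^-monoʳ-≤ 2 {1} (ℕ.≤-trans (s≤s z≤n) (ℕ.≤-trans (ℕ.m≤n+m 2 d) d+2≤M))
  d<A : suc d < A
  d<A = ℕ.<-≤-trans (n<b^n 0 (suc d)) (ℕ.^-monoʳ-≤ 2 (ℕ.≤-trans (ℕ.≤-trans (ℕ.n≤1+n (suc d)) (ℕ.≤-reflexive (ℕ.+-comm 2 d))) d+2≤M))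
  length≤ : suc (d * L) ≤ suc d * A
  length≤ = ℕ.+-mono-≤ 1≤A (ℕ.*-monoʳ-≤ d (ℕ.≤-trans (ℕ.n≤1+n L) (ℕ.≤-reflexive sucL≡A)))
  MA+A≤A² : A + M * A ≤ A * A
  MA+A≤A² = ℕ.*-monoˡ-≤ A (n<b^n 0 M)
  width≤ : suc (M * A + M * A) ≤ A * A + A * A
  width≤ = ℕ.≤-trans (s≤s (ℕ.+-monoʳ-≤ (M * A) (ℕ.m≤n+m (M * A) A)))
    (ℕ.+-mono-≤ (ℕ.≤-trans (ℕ.+-monoˡ-≤ (M * A) 1≤A) MA+A≤A²) MA+A≤A²)
  lemma : ∀ s A → s * A * (A * A + A * A) ≡ s * (2 * (A * A * A))
  lemma = solve-∀
  lemma′ : ∀ A → A * (A * (A * A * A)) ≡ A ^ 5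
  lemma′ A = l A
    where
    l : ∀ A → A * (A * (A * A * A)) ≡ A * (A * (A * (A * (A * 1))))
    l = solve-∀

-- `n` is below `2 ^ (5 * (M + 1))`, hence at most `2 ^ (10 * M)`, so its logarithm is at most
-- `10 * M`. This factor 10 enters once through the base `n` and once through the exponent, giving
-- 100.
powLogBound : ∀ n d M s → 1 ≤ M → n < 32 ^ suc M → (2 ^ M) ^ (d * M) ≤ s → PowLogBound n d 100 s
powLogBound n d M s 1≤M n<32^ N≤s p q 0<p 2^q≤n^p = begin
  n ^ (d * q)                     ≤⟨ ℕ.^-monoˡ-≤ (d * q) n≤2^10M ⟩
  (2 ^ (10 * M)) ^ (d * q)        ≡⟨ ℕ.^-*-assoc 2 (10 * M) (d * q) ⟩
  2 ^ (10 * M * (d * q))          ≤⟨ ℕ.^-monoʳ-≤ 2 (ℕ.*-monoʳ-≤ (10 * M) (ℕ.*-monoʳ-≤ d q≤)) ⟩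
  2 ^ (10 * M * (d * (10 * M * p)))  ≡⟨ cong (2 ^_) (lemma M d p) ⟩
  2 ^ (M * (d * M) * (100 * p))   ≡⟨ ℕ.^-*-assoc 2 (M * (d * M)) (100 * p) ⟨
  (2 ^ (M * (d * M))) ^ (100 * p) ≡⟨ cong (_^ (100 * p)) (ℕ.^-*-assoc 2 M (d * M)) ⟨
  ((2 ^ M) ^ (d * M)) ^ (100 * p) ≤⟨ ℕ.^-monoˡ-≤ (100 * p) N≤s ⟩
  s ^ (100 * p)                   ∎
  where
  open ℕ.≤-Reasoning
  lemma : ∀ M d p → 10 * M * (d * (10 * M * p)) ≡ M * (d * M) * (100 * p)
  lemma = solve-∀
  n≤2^10M : n ≤ 2 ^ (10 * M)
  n≤2^10M = begin
    n                 ≤⟨ ℕ.<⇒≤ n<32^ ⟩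
    32 ^ suc M        ≡⟨ ℕ.^-*-assoc 2 5 (suc M) ⟩
    2 ^ (5 * suc M)   ≤⟨ ℕ.^-monoʳ-≤ 2 {5 * suc M} {10 * M} (begin
      5 * suc M       ≤⟨ ℕ.*-monoʳ-≤ 5 (ℕ.+-monoˡ-≤ M 1≤M) ⟩
      5 * (M + M)     ≡⟨ double M ⟩
      10 * M          ∎) ⟩
    2 ^ (10 * M)      ∎
    where
    double : ∀ M → 5 * (M + M) ≡ 10 * M
    double = solve-∀
  q≤ : q ≤ 10 * M * p
  q≤ with q ℕ.≤? 10 * M * p
  ... | yes h = h
  ... | no  h = contradiction 2^q≤n^p (ℕ.<⇒≱ (begin-strict
    n ^ p                ≤⟨ ℕ.^-monoˡ-≤ p n≤2^10M ⟩
    (2 ^ (10 * M)) ^ p   ≡⟨ ℕ.^-*-assoc 2 (10 * M) p ⟩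
    2 ^ (10 * M * p)     <⟨ ℕ.^-monoʳ-< 2 (s≤s (s≤s z≤n)) (ℕ.≰⇒> h) ⟩
    2 ^ q                ∎))

Solution : ℕ → ℕ → Set
Solution d n = Σ[ G ∈ ParamGraph d n ]
  (ParamGraph.Acyclic G
  × ¬ ¬ (∃[ S ] ParamGraph.IsMSPC G S)
  × (32 ^ (d + 2) ≤ n → ∀ S → ParamGraph.IsMSPC G S → PowLogBound n d 100 (length S)))

-- Below the threshold only existence is at stake: a directed path of `n` vertices whose source is
-- also its sink.
small-solution : ∀ d n → 0 < n → n < 32 ^ (d + 2) → Solution d n
small-solution d n 0<n n<n₀ =
  grid , acyclic , mspc-exists ε , λ n₀≤n → contradiction n₀≤n (ℕ.<⇒≱ n<n₀)
  where open LayeredGrid d n 1 0 0<n (inj₁ refl) 0<n (λ _ _ _ _ → 0ℤ) (λ _ _ _ → 0ℤ)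

large-solution : ∀ d n M → 0 < n → d + 2 ≤ M → 32 ^ M ≤ n → n < 32 ^ suc M → Solution d n
large-solution d n zero    0<n d+2≤0 = contradiction (ℕ.≤-trans (ℕ.m≤n+m 2 d) d+2≤0) λ ()
large-solution d n (suc m) 0<n d+2≤M 32^M≤n n<32^ =
  -- Any walk would do here; it only shows that the sink can be reached.
  grid , acyclic , mspc-exists (walk 0<n W<n DW<n 0) ,
  λ _ S mspc → powLogBound n d (suc m) (length S) (s≤s z≤n) n<32^ (mspc-size 0<n W<n DW<n S mspc)
  where
  open Series d n m (2 ^ suc m) {{ℕ.m^n≢0 2 (suc m)}}
  DW<n : D * W < n
  DW<n = ℕ.<-≤-trans (grid-fits d L (suc m) (length-level R m) d+2≤M) 32^M≤n
  W<n : W < n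
  W<n = ℕ.≤-<-trans (ℕ.m≤m+n W (d * L * W)) DW<n
  open LayeredGrid d n W D 0<n (inj₂ W<n) DW<n slope intercept

solution : ∀ d n → 0 < n → Solution d n
solution d n 0<n with 32 ^ (d + 2) ℕ.≤? n
... | no  n₀≰n = small-solution d n 0<n (ℕ.≰⇒> n₀≰n)
... | yes n₀≤n with log-search 32 n n 0<n (n<b^n 30 n)
...   | M , 32^M≤n , n< = large-solution d n M 0<n d+2≤M 32^M≤n n<
  where
  d+2≤M : d + 2 ≤ M
  d+2≤M with d + 2 ℕ.≤? M
  ... | yes h = h
  ... | no  h = contradiction (ℕ.≤-trans (ℕ.^-monoʳ-≤ 32 (ℕ.≰⇒> h)) n₀≤n) (ℕ.<⇒≱ n<)

claim14 : ∃[ k ] (0 < k ×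
    (∀ d → 0 < d →
    ∃[ n₀ ] (∀ n → 0 < n →
    Σ[ G ∈ ParamGraph d n ]
    (ParamGraph.Acyclic G
    × ¬ ¬ (∃[ S ] ParamGraph.IsMSPC G S)
    × (n₀ ≤ n → ∀ S → ParamGraph.IsMSPC G S → PowLogBound n d k (length S))))))
claim14 = 100 , s≤s z≤n , λ d _ → 32 ^ (d + 2) , solution d
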